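{- There is an absolute constant $C>0$ such that for every positive integer $d$ and all $\alpha,\beta\in[0,1]$ with $\alpha>\beta$, the $(\alpha,\beta,d,\ell)$-InnerProduct problem can be solved with space \[ \ell \le d\log_2\!\left(\frac{\sqrt{1-\beta}}{\alpha-\beta}\right)+C d . \]
   Context: $\mathbb{S}^{d-1}$ denotes the Euclidean unit sphere in $\mathbb{R}^d$, and $\langle x,y\rangle=\sum_{i=1}^d x_iy_i$. For positive integers $d,\ell$ and $\alpha,\beta\in[0,1]$ with $\alpha>\beta$, the $(\alpha,\beta,d,\ell)$-InnerProduct problem is to construct maps $\mathcal{E}:\mathbb{S}^{d-1}\to\{0,1\}^\ell$ and $\mathcal{D}:\{0,1\}^\ell\to\mathbb{S}^{d-1}$ and a threshold $t\in\mathbb{R}$ such that for all $x,y\in\mathbb{S}^{d-1}$: - if $\langle x,y\rangle\ge\alpha$ then $\langle \mathcal{D}(\mathcal{E}(x)),\mathcal{D}(\mathcal{E}(y))\rangle\ge t$; - if $\langle x,y\rangle\le\beta$ then $\langle \mathcal{D}(\mathcal{E}(x)),\mathcal{D}(\mathcal{E}(y))\rangle< t$. The problem is solved with space $\ell$ if such $\mathcal{E},\mathcal{D},t$ exist. -}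

module Defs where

open import Algebra.Bundles using (CommutativeRing; Semiring)
import Algebra.Definitions.RawSemiring as RawSemiringDefinitions
import Algebra.Properties.Semiring.Sum as SemiringSum
open import Axiom.ExcludedMiddle using (ExcludedMiddle)
open import Data.Bool.Base using (Bool)
open import Data.Integer.Base using (ℤ; +_; -[1+_])
open import Data.Nat.Base using (ℕ; suc)
open import Data.Product.Base using (Σ; ∃; _×_; _,_; proj₁)
open import Data.Rational.Unnormalised.Base using (ℚᵘ; ↥_; ↧ₙ_)
open import Data.Vec.Base using (Vec)
open import Data.Vec.Functional using (Vector)
import Data.Vec.Functional.Relation.Binary.Equality.Setoid as VectorEquality
open import Level using (0ℓ)
open import Relation.Binary.Core using (Rel)
open import Relation.Binary.Bundles using (Setoid)
import Relation.Binary.Construct.NonStrictToStrict as ToStrict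
import Relation.Binary.Construct.On as On
open import Relation.Binary.PropositionalEquality.Core using (_≡_)
open import Relation.Binary.Structures using (IsTotalOrder)
open import Relation.Nullary.Decidable.Core using (yes; no)
open import Relation.Nullary.Negation.Core using (¬_)

module _ {A : Set} (_≤_ : Rel A 0ℓ) where

  IsUpperBound : (A → Set) → A → Set
  IsUpperBound P b = ∀ x → P x → x ≤ b

  IsSupremum : (A → Set) → A → Set
  IsSupremum P s = IsUpperBound P s × (∀ b → IsUpperBound P b → s ≤ b)

-- The classical axioms of the real numbers (unique up to isomorphism under
-- excluded middle).
record CompleteOrderedField : Set₁ where
  infix 4 _≤_
  infixl 7 _/_
  infix 8 _⁻¹

  field
    commutativeRing : CommutativeRing 0ℓ 0ℓ

  open CommutativeRing commutativeRing public

  field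
    _≤_          : Rel Carrier 0ℓ
    isTotalOrder : IsTotalOrder _≈_ _≤_
    +-monoʳ-≤    : ∀ z {x y} → x ≤ y → z + x ≤ z + y
    *-nonneg     : ∀ {x y} → 0# ≤ x → 0# ≤ y → 0# ≤ x * y
    1≉0          : 1# ≉ 0#
    -- The value of 0# ⁻¹ is unspecified.
    _⁻¹          : Carrier → Carrier
    ⁻¹-inverseʳ  : ∀ {x} → x ≉ 0# → x * x ⁻¹ ≈ 1#
    supremum     : (P : Carrier → Set) → ∃ P → ∃ (IsUpperBound _≤_ P) →
                   ∃ (IsSupremum _≤_ P)

  open ToStrict _≈_ _≤_ public using (_<_)

  _/_ : Carrier → Carrier → Carrier
  x / y = x * y ⁻¹

-- Excluded middle provides the classical logic of ordinary real analysis.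
module RealAnalysis (em : ExcludedMiddle 0ℓ) (R : CompleteOrderedField) where

  open CompleteOrderedField R public
  open RawSemiringDefinitions (Semiring.rawSemiring semiring) public
    using (_^_) renaming (_×_ to _×ᴿ_)
  open SemiringSum semiring public using (sum-syntax)

  ℝ : Set
  ℝ = Carrier

  fromℕ : ℕ → ℝ
  fromℕ n = n ×ᴿ 1#

  fromℤ : ℤ → ℝ
  fromℤ (+ n)    = fromℕ n
  fromℤ -[1+ n ] = - fromℕ (suc n)

  fromℚ : ℚᵘ → ℝ
  fromℚ q = fromℤ (↥ q) / fromℕ (↧ₙ q)

  -- The number satisfying P, or 0# if there is none. Only used for predicates
  -- with at most one solution up to _≈_.
  the : (ℝ → Set) → ℝ
  the P with em {P = ∃ P}
  ... | yes (x , _) = x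
  ... | no  _       = 0#

  infix 9 √_
  √_ : ℝ → ℝ
  √ x = the λ s → 0# ≤ s × s * s ≈ x

  infixr 8 _^ᶻ_
  _^ᶻ_ : ℝ → ℤ → ℝ
  x ^ᶻ (+ n)    = x ^ n
  x ^ᶻ -[1+ n ] = (x ^ suc n) ⁻¹

  -- a = 2^q for rational q = m/n, i.e. a is the nonnegative n-th root of 2^m.
  IsRationalPowerOf2 : ℚᵘ → ℝ → Set
  IsRationalPowerOf2 q a = 0# ≤ a × a ^ (↧ₙ q) ≈ fromℕ 2 ^ᶻ (↥ q)

  -- 2^y = sup { 2^q | q ∈ ℚ, q ≤ y }
  exp₂ : ℝ → ℝ
  exp₂ y = the (IsSupremum _≤_ λ a →
    Σ ℚᵘ λ q → fromℚ q ≤ y × IsRationalPowerOf2 q a)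

  log₂ : ℝ → ℝ
  log₂ x = the λ y → exp₂ y ≈ x

  ⟨_,_⟩ : ∀ {d} → Vector ℝ d → Vector ℝ d → ℝ
  ⟨_,_⟩ {d} x y = ∑[ i < d ] (x i * y i)

  -- The sphere in ℝᵈ, which is 𝕊ᵈ⁻¹ in the usual indexing.
  Sphere : ℕ → Setoid 0ℓ 0ℓ
  Sphere d = On.setoid {B = Σ (Vector ℝ d) λ x → ⟨ x , x ⟩ ≈ 1#}
                       (VectorEquality.≋-setoid setoid d) proj₁

  SpherePoint : ℕ → Set
  SpherePoint d = Setoid.Carrier (Sphere d)

  ⟪_,_⟫ : ∀ {d} → SpherePoint d → SpherePoint d → ℝ
  ⟪ x , y ⟫ = ⟨ proj₁ x , proj₁ y ⟩

  record InnerProductSolution (α β : ℝ) (d ℓ : ℕ) : Set where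
    open Setoid (Sphere d) using () renaming (_≈_ to _≈ˢ_)
    field
      encode      : SpherePoint d → Vec Bool ℓ
      -- encode is a map on the sphere itself, where equality is _≈ˢ_.
      encode-cong : ∀ {x y} → x ≈ˢ y → encode x ≡ encode y
      decode      : Vec Bool ℓ → SpherePoint d
      t           : ℝ
      close       : ∀ x y → α ≤ ⟪ x , y ⟫ →
                    t ≤ ⟪ decode (encode x) , decode (encode y) ⟫
      far         : ∀ x y → ⟪ x , y ⟫ ≤ β →
                    ⟪ decode (encode x) , decode (encode y) ⟫ < t

{-# OPTIONS --safe #-}
module Submission where

-- Two points of the sphere are separated by an inner product gap between α and β as long as each
-- of them is known up to a distance of order (α − β) / √(1 − β): by weighted AM–GM, moving both
-- points changes the squared distance |x − y|² = 2 − 2⟨x,y⟩ by a small relative amount plus a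
-- small absolute one.  So it suffices to encode the sphere such that points with the same code
-- have distance at most 2⁻ᵏ with 2ᵏ of order X = √(1 − β) / (α − β), and to decode to any point
-- with the given code.  For this, round the coordinates of √d 2ᵏ x to integers zᵢ towards 0 and write
-- each of them in Golomb–Rice form: a sign, the k low bits of |zᵢ| and the quotient
-- qᵢ = ⌊|zᵢ| / 2ᵏ⌋ in unary.  Since qᵢ ≤ qᵢ² ≤ d xᵢ², the quotients sum to at most d, and
-- d (k + 3) bits are enough.

open import Defs
open import Algebra.Bundles using (CommutativeRing)
import Algebra.Properties.CommutativeSemiring.Exp as CommutativeSemiringExp
import Algebra.Properties.Ring as RingProperties
import Algebra.Properties.Semiring.Exp as SemiringExp
import Algebra.Properties.Semiring.Mult as SemiringMult
import Algebra.Properties.Semiring.Mult.TCOptimised as OptimisedMult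
import Algebra.Solver.Ring as RingSolver
open import Algebra.Solver.Ring.AlmostCommutativeRing
  using (fromCommutativeRing; _-Raw-AlmostCommutative⟶_)
open import Axiom.ExcludedMiddle using (ExcludedMiddle)
open import Data.Bool.Base using (Bool; true; false)
open import Data.Empty using (⊥-elim)
open import Data.Fin.Base using (Fin; zero; suc)
open import Data.Integer.Base as ℤ using (ℤ; +_; -[1+_]; _⊖_)
import Data.Integer.Properties as ℤ
open import Data.List.Base using (List; []; _∷_; _++_; length)
open import Data.List.Properties using (∷-injective; ∷-injectiveʳ; ++-assoc; length-++)
open import Data.Maybe.Base using (Maybe; just; nothing)
open import Data.Nat.Base as ℕ using (ℕ; zero; suc; z≤n; s≤s; ⌊_/2⌋; NonZero)
import Data.Nat.Properties as ℕ
open import Data.Product.Base using (Σ; ∃; _×_; _,_; proj₁; proj₂)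
open import Data.Rational.Unnormalised.Base using (ℚᵘ; mkℚᵘ)
open import Data.Sum.Base using (inj₁; inj₂)
open import Data.Vec.Base as Vec using (Vec)
open import Data.Vec.Functional using (Vector)
open import Function.Base using (_∘_)
open import Level using (0ℓ)
open import Relation.Binary.Bundles using (Poset)
import Relation.Binary.Construct.NonStrictToStrict as Strict
open import Relation.Binary.PropositionalEquality as ≡ using (_≡_)
import Relation.Binary.Reasoning.PartialOrder as PartialOrderReasoning
import Relation.Binary.Reasoning.Setoid as SetoidReasoning
open import Relation.Binary.Structures using (IsTotalOrder)
open import Relation.Nullary.Decidable.Core using (yes; no)
open import Relation.Nullary.Negation.Core using (¬_; contradiction)

-- Golomb–Rice codes

-- A block of fixed length per coordinate would have to hold integers up to √d 2ᵏ and would cost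
-- about d log₂ √d bits too many. Any one coordinate may be that large, but all of them share a
-- squared norm of d 4ᵏ; only a code of variable length exploits this, and it has to be prefix-free
-- to remain readable. The precision is dictated by pairs at the critical distance: where 1 - ⟨x,y⟩
-- is near 1 - β, moving the points by η changes it by about η √(1 - β), and this must stay below α
-- - β. A threshold for decoded points needs control in both directions, from the given pair to the
-- decoded one and back, so the perturbation bound is spent twice within one gap. Since `exp₂` and
-- `log₂` are known only through suprema and descriptions, the comparison of log₂ X with integers is
-- built from completeness. It may lose 1, which costs only d further bits.

odd : ℕ → Bool
odd 0             = false
odd 1             = true
odd (suc (suc n)) = odd n

⌊/2⌋-odd-injective : ∀ m n → odd m ≡ odd n → ⌊ m /2⌋ ≡ ⌊ n /2⌋ → m ≡ n
⌊/2⌋-odd-injective 0 0 _ _ = ≡.refl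
⌊/2⌋-odd-injective 0 (suc (suc n)) _ ()
⌊/2⌋-odd-injective 1 1 _ _ = ≡.refl
⌊/2⌋-odd-injective 1 (suc (suc n)) _ ()
⌊/2⌋-odd-injective (suc (suc m)) 0 _ ()
⌊/2⌋-odd-injective (suc (suc m)) 1 _ ()
⌊/2⌋-odd-injective (suc (suc m)) (suc (suc n)) p q =
  ≡.cong (2 ℕ.+_) (⌊/2⌋-odd-injective m n p (ℕ.suc-injective q))

2*⌊n/2⌋≤n : ∀ n → 2 ℕ.* ⌊ n /2⌋ ℕ.≤ n
2*⌊n/2⌋≤n 0 = z≤n
2*⌊n/2⌋≤n 1 = z≤n
2*⌊n/2⌋≤n (suc (suc n)) =
  ≡.subst (ℕ._≤ suc (suc n)) (≡.sym (ℕ.*-suc 2 ⌊ n /2⌋)) (s≤s (s≤s (2*⌊n/2⌋≤n n)))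

⌊_/2^_⌋ : ℕ → ℕ → ℕ
⌊ n /2^ zero  ⌋ = n
⌊ n /2^ suc k ⌋ = ⌊ ⌊ n /2⌋ /2^ k ⌋

2^k*⌊n/2^k⌋≤n : ∀ k n → 2 ℕ.^ k ℕ.* ⌊ n /2^ k ⌋ ℕ.≤ n
2^k*⌊n/2^k⌋≤n zero    n = ℕ.≤-reflexive (ℕ.*-identityˡ n)
2^k*⌊n/2^k⌋≤n (suc k) n = begin
  2 ℕ.* 2 ℕ.^ k ℕ.* q     ≡⟨ ℕ.*-assoc 2 (2 ℕ.^ k) q ⟩
  2 ℕ.* (2 ℕ.^ k ℕ.* q)   ≤⟨ ℕ.*-monoʳ-≤ 2 (2^k*⌊n/2^k⌋≤n k ⌊ n /2⌋) ⟩
  2 ℕ.* ⌊ n /2⌋           ≤⟨ 2*⌊n/2⌋≤n n ⟩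
  n                       ∎
  where
  open ℕ.≤-Reasoning
  q = ⌊ ⌊ n /2⌋ /2^ k ⌋

golomb : ℕ → ℕ → List Bool
golomb zero    zero    = false ∷ []
golomb zero    (suc n) = true ∷ golomb zero n
golomb (suc k) n       = odd n ∷ golomb k ⌊ n /2⌋

length-golomb : ∀ k n → length (golomb k n) ≡ suc k ℕ.+ ⌊ n /2^ k ⌋
length-golomb zero    zero    = ≡.refl
length-golomb zero    (suc n) = ≡.cong suc (length-golomb zero n)
length-golomb (suc k) n       = ≡.cong suc (length-golomb k ⌊ n /2⌋)

-- The parameter `k` fixes the number of low bits, and the final `false` marks the end of the unary
-- part. The remainders `r` and `s` are what lets codes be concatenated without length fields.
golomb-prefixFree : ∀ k m n {r s} → golomb k m ++ r ≡ golomb k n ++ s → m ≡ n × r ≡ s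
golomb-prefixFree zero zero    zero    eq = ≡.refl , ∷-injectiveʳ eq
golomb-prefixFree zero (suc m) (suc n) eq =
  let m≡n , r≡s = golomb-prefixFree zero m n (∷-injectiveʳ eq) in ≡.cong suc m≡n , r≡s
golomb-prefixFree (suc k) m n eq =
  let b≡ , eq′ = ∷-injective eq
      h≡ , r≡s = golomb-prefixFree k ⌊ m /2⌋ ⌊ n /2⌋ eq′
  in ⌊/2⌋-odd-injective m n b≡ h≡ , r≡s

codes : ∀ {n} → ℕ → (Fin n → Bool × ℕ) → List Bool
codes {zero}  k p = []
codes {suc n} k p = proj₁ (p zero) ∷ golomb k (proj₂ (p zero)) ++ codes k (p ∘ suc)

codes-cong : ∀ {n} k {p q : Fin n → Bool × ℕ} → (∀ i → p i ≡ q i) → codes k p ≡ codes k q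
codes-cong {zero}  k eq = ≡.refl
codes-cong {suc n} k eq =
  ≡.cong₂ (λ c cs → proj₁ c ∷ golomb k (proj₂ c) ++ cs) (eq zero) (codes-cong k (eq ∘ suc))

codes-prefixFree : ∀ {n} k (p q : Fin n → Bool × ℕ) {r s} →
                   codes k p ++ r ≡ codes k q ++ s → ∀ i → p i ≡ q i
codes-prefixFree {suc n} k p q {r} {s} eq i
  with ∷-injective eq
... | b≡ , eq′
  with golomb-prefixFree k (proj₂ (p zero)) (proj₂ (q zero))
         (≡.trans (≡.sym (++-assoc (golomb k (proj₂ (p zero))) _ r))
           (≡.trans eq′ (++-assoc (golomb k (proj₂ (q zero))) _ s)))
... | m≡ , eq″ with i
...   | zero  = ≡.cong₂ _,_ b≡ m≡
...   | suc j = codes-prefixFree k (p ∘ suc) (q ∘ suc) eq″ j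

-- Padding to a fixed length

pad : (ℓ : ℕ) → List Bool → Vec Bool ℓ
pad zero    _        = Vec.[]
pad (suc ℓ) []       = false Vec.∷ pad ℓ []
pad (suc ℓ) (x ∷ xs) = x Vec.∷ pad ℓ xs

toList-pad : ∀ ℓ xs → length xs ℕ.≤ ℓ → ∃ λ r → Vec.toList (pad ℓ xs) ≡ xs ++ r
toList-pad zero    []       _       = [] , ≡.refl
toList-pad (suc ℓ) []       _       = _ , ≡.refl
toList-pad (suc ℓ) (x ∷ xs) (s≤s p) =
  let r , eq = toList-pad ℓ xs p in r , ≡.cong (x ∷_) eq

-- The length hypotheses exclude truncation by `pad`. The padding then is just a remainder after a
-- prefix-free code, so its own length need not be recorded.
pad-codes-injective : ∀ {n} ℓ k (p q : Fin n → Bool × ℕ) →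
                      length (codes k p) ℕ.≤ ℓ → length (codes k q) ℕ.≤ ℓ →
                      pad ℓ (codes k p) ≡ pad ℓ (codes k q) → ∀ i → p i ≡ q i
pad-codes-injective ℓ k p q p≤ q≤ eq =
  let r , p≡ = toList-pad ℓ (codes k p) p≤
      s , q≡ = toList-pad ℓ (codes k q) q≤
  in codes-prefixFree k p q (≡.trans (≡.sym p≡) (≡.trans (≡.cong Vec.toList eq) q≡))

-- A ring solver

-- The solver with integer coefficients normalises x - x to 0#, which coefficients taken
-- from an abstract ring do not.
module IntegerCoefficients (R : CommutativeRing 0ℓ 0ℓ) where

  open CommutativeRing R hiding (zero)
  open RingProperties ring
  open OptimisedMult semiring renaming (_×_ to _×′_)
  open SetoidReasoning setoid

  ⟦_⟧ : ℤ → Carrier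
  ⟦ + n ⟧      = n ×′ 1#
  ⟦ -[1+ n ] ⟧ = - (suc n ×′ 1#)

  private
    ring′ = fromCommutativeRing R

    -‿homo : ∀ i → ⟦ ℤ.- i ⟧ ≈ - ⟦ i ⟧
    -‿homo (+ zero)   = sym -0#≈0#
    -‿homo (+ suc n)  = refl
    -‿homo -[1+ n ]   = sym (-‿involutive _)

    cancel : ∀ a b → (1# + a) - (1# + b) ≈ a - b
    cancel a b = begin
      (1# + a) - (1# + b)     ≈⟨ +-congˡ (-‿+-comm 1# b) ⟨
      (1# + a) + (- 1# - b)   ≈⟨ +-congʳ (+-comm 1# a) ⟩
      (a + 1#) + (- 1# - b)   ≈⟨ +-assoc a 1# _ ⟩
      a + (1# + (- 1# - b))   ≈⟨ +-congˡ (+-assoc 1# _ _) ⟨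
      a + ((1# - 1#) - b)     ≈⟨ +-congˡ (+-congʳ (-‿inverseʳ 1#)) ⟩
      a + (0# - b)            ≈⟨ +-congˡ (+-identityˡ _) ⟩
      a - b                   ∎

    ⊖-homo : ∀ m n → ⟦ m ⊖ n ⟧ ≈ m ×′ 1# - n ×′ 1#
    ⊖-homo m zero = begin
      ⟦ m ⊖ 0 ⟧      ≡⟨ ≡.cong ⟦_⟧ (ℤ.⊖-≥ {m} ℕ.z≤n) ⟩
      m ×′ 1#        ≈⟨ +-identityʳ _ ⟨
      m ×′ 1# + 0#   ≈⟨ +-congˡ -0#≈0# ⟨
      m ×′ 1# - 0#   ∎
    ⊖-homo zero (suc n) = sym (+-identityˡ _)
    ⊖-homo (suc m) (suc n) = begin
      ⟦ suc m ⊖ suc n ⟧                 ≡⟨ ≡.cong ⟦_⟧ (ℤ.[1+m]⊖[1+n]≡m⊖n m n) ⟩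
      ⟦ m ⊖ n ⟧                         ≈⟨ ⊖-homo m n ⟩
      m ×′ 1# - n ×′ 1#                 ≈⟨ cancel _ _ ⟨
      (1# + m ×′ 1#) - (1# + n ×′ 1#)   ≈⟨ +-cong (1+× m 1#) (-‿cong (1+× n 1#)) ⟨
      suc m ×′ 1# - suc n ×′ 1#         ∎

    +-homo : ∀ i j → ⟦ i ℤ.+ j ⟧ ≈ ⟦ i ⟧ + ⟦ j ⟧
    +-homo (+ m)    (+ n)    = ×-homo-+ 1# m n
    +-homo (+ m)    -[1+ n ] = ⊖-homo m (suc n)
    +-homo -[1+ m ] (+ n)    = trans (⊖-homo n (suc m)) (+-comm _ _)
    +-homo -[1+ m ] -[1+ n ] = begin
      - (suc (suc (m ℕ.+ n)) ×′ 1#)   ≡⟨ ≡.cong (λ k → - (suc k ×′ 1#)) (ℕ.+-suc m n) ⟨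
      - ((suc m ℕ.+ suc n) ×′ 1#)     ≈⟨ -‿cong (×-homo-+ 1# (suc m) (suc n)) ⟩
      - (suc m ×′ 1# + suc n ×′ 1#)   ≈⟨ -‿+-comm _ _ ⟨
      - (suc m ×′ 1#) - suc n ×′ 1#   ∎

    *-homo : ∀ i j → ⟦ i ℤ.* j ⟧ ≈ ⟦ i ⟧ * ⟦ j ⟧
    *-homo (+ m) (+ n) = trans (reflexive (≡.cong ⟦_⟧ (ℤ.+◃n≡+n (m ℕ.* n)))) (×1-homo-* m n)
    *-homo (+ m) -[1+ n ] = begin
      ⟦ + m ℤ.* -[1+ n ] ⟧          ≡⟨ ≡.cong ⟦_⟧ (ℤ.-◃n≡-n (m ℕ.* suc n)) ⟩
      ⟦ ℤ.- (+ (m ℕ.* suc n)) ⟧     ≈⟨ -‿homo (+ (m ℕ.* suc n)) ⟩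
      - ((m ℕ.* suc n) ×′ 1#)       ≈⟨ -‿cong (×1-homo-* m (suc n)) ⟩
      - (m ×′ 1# * (suc n ×′ 1#))   ≈⟨ -‿distribʳ-* _ _ ⟩
      m ×′ 1# * - (suc n ×′ 1#)     ∎
    *-homo -[1+ m ] (+ n) = begin
      ⟦ -[1+ m ] ℤ.* + n ⟧          ≡⟨ ≡.cong ⟦_⟧ (ℤ.-◃n≡-n (suc m ℕ.* n)) ⟩
      ⟦ ℤ.- (+ (suc m ℕ.* n)) ⟧     ≈⟨ -‿homo (+ (suc m ℕ.* n)) ⟩
      - ((suc m ℕ.* n) ×′ 1#)       ≈⟨ -‿cong (×1-homo-* (suc m) n) ⟩
      - (suc m ×′ 1# * (n ×′ 1#))   ≈⟨ -‿distribˡ-* _ _ ⟩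
      - (suc m ×′ 1#) * (n ×′ 1#)   ∎
    *-homo -[1+ m ] -[1+ n ] = begin
      (suc m ℕ.* suc n) ×′ 1#               ≈⟨ ×1-homo-* (suc m) (suc n) ⟩
      suc m ×′ 1# * (suc n ×′ 1#)           ≈⟨ -‿involutive _ ⟨
      - - (suc m ×′ 1# * (suc n ×′ 1#))     ≈⟨ -‿cong (-‿distribˡ-* _ _) ⟩
      - (- (suc m ×′ 1#) * (suc n ×′ 1#))   ≈⟨ -‿distribʳ-* _ _ ⟩
      - (suc m ×′ 1#) * - (suc n ×′ 1#)     ∎

    morphism : CommutativeRing.rawRing ℤ.+-*-commutativeRing -Raw-AlmostCommutative⟶ ring′
    morphism = record
      { ⟦_⟧    = ⟦_⟧
      ; +-homo = +-homo
      ; *-homo = *-homo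
      ; -‿homo = -‿homo
      ; 0-homo = refl
      ; 1-homo = refl
      }

    ⟦⟧-≟ : ∀ i j → Maybe (⟦ i ⟧ ≈ ⟦ j ⟧)
    ⟦⟧-≟ i j with i ℤ.≟ j
    ... | yes i≡j = just (reflexive (≡.cong ⟦_⟧ i≡j))
    ... | no  _   = nothing

  open RingSolver (CommutativeRing.rawRing ℤ.+-*-commutativeRing) ring′ morphism ⟦⟧-≟ public
    using (Polynomial; solve; con; _:=_; _:+_; _:*_; _:-_; :-_)

  num : ∀ {n} → ℕ → Polynomial n
  num k = con (+ k)

module InnerProductCoding (em : ExcludedMiddle 0ℓ) (R : CompleteOrderedField) where

  open RealAnalysis em R hiding (zero)
  open IntegerCoefficients commutativeRing
  open IsTotalOrder isTotalOrder using (total; antisym; ≤-respˡ-≈; ≤-respʳ-≈; isPartialOrder)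
    renaming (refl to ≤-refl; trans to ≤-trans; reflexive to ≤-reflexive)
  open OptimisedMult semiring using (×ᵤ≈×)
  open SemiringExp semiring using (^-congˡ; ^-homo-*; ^-assocʳ)
  open CommutativeSemiringExp commutativeSemiring using (^-distrib-*)
  open SemiringMult semiring using (×1-homo-*; ×-homo-+)

  -- Ordered field arithmetic

  poset : Poset 0ℓ 0ℓ 0ℓ
  poset = record { isPartialOrder = isPartialOrder }
  module ≤-Reasoning = PartialOrderReasoning poset

  -- Definitionally the value of the solver's `num 2`, whereas `fromℕ 2` is `1# + (1# + 0#)`.
  2# : ℝ
  2# = 1# + 1#

  <⇒≤ : ∀ {x y} → x < y → x ≤ y
  <⇒≤ = proj₁

  <⇒≱ : ∀ {x y} → x < y → ¬ y ≤ x
  <⇒≱ = Strict.<⇒≱ _≈_ _≤_ antisym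

  ≰⇒> : ∀ {x y} → ¬ x ≤ y → y < x
  ≰⇒> = Strict.≰⇒> _≈_ _≤_ sym ≤-reflexive total

  ≮⇒≥ : ∀ {x y} → ¬ x < y → y ≤ x
  ≮⇒≥ = Strict.≮⇒≥ _≈_ _≤_ sym (λ _ _ → em) ≤-reflexive total

  <-≤-trans : ∀ {x y z} → x < y → y ≤ z → x < z
  <-≤-trans = Strict.<-≤-trans _≈_ _≤_ sym ≤-trans antisym ≤-respʳ-≈

  ≤-<-trans : ∀ {x y z} → x ≤ y → y < z → x < z
  ≤-<-trans = Strict.≤-<-trans _≈_ _≤_ ≤-trans antisym ≤-respˡ-≈

  ≤-from-difference : ∀ {x y e} → 0# ≤ e → e ≈ y - x → x ≤ y
  ≤-from-difference {x} {y} {e} 0≤e e≈ = begin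
    x             ≈⟨ +-identityʳ x ⟨
    x + 0#        ≤⟨ +-monoʳ-≤ x 0≤e ⟩
    x + e         ≈⟨ +-congˡ e≈ ⟩
    x + (y - x)   ≈⟨ solve 2 (λ x y → x :+ (y :- x) := y) refl x y ⟩
    y             ∎
    where open ≤-Reasoning

  difference-nonneg : ∀ {x y} → x ≤ y → 0# ≤ y - x
  difference-nonneg {x} {y} x≤y = begin
    0#        ≈⟨ -‿inverseˡ x ⟨
    - x + x   ≤⟨ +-monoʳ-≤ (- x) x≤y ⟩
    - x + y   ≈⟨ +-comm (- x) y ⟩
    y - x     ∎
    where open ≤-Reasoning

  difference-pos : ∀ {x y} → x < y → 0# < y - x
  difference-pos {x} {y} x<y = difference-nonneg (<⇒≤ x<y) , λ 0≈y-x →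
    proj₂ x<y (trans (sym (+-identityʳ x)) (trans (+-congˡ 0≈y-x)
      (solve 2 (λ x y → x :+ (y :- x) := y) refl x y)))

  +-mono-≤ : ∀ {x y u v} → x ≤ y → u ≤ v → x + u ≤ y + v
  +-mono-≤ {x} {y} {u} {v} x≤y u≤v = begin
    x + u   ≤⟨ +-monoʳ-≤ x u≤v ⟩
    x + v   ≈⟨ +-comm x v ⟩
    v + x   ≤⟨ +-monoʳ-≤ v x≤y ⟩
    v + y   ≈⟨ +-comm v y ⟩
    y + v   ∎
    where open ≤-Reasoning

  +-monoʳ-< : ∀ z {x y} → x < y → z + x < z + y
  +-monoʳ-< z {x} {y} x<y = +-monoʳ-≤ z (<⇒≤ x<y) , λ eq → proj₂ x<y (begin-equality
    x             ≈⟨ solve 2 (λ z x → x := (z :+ x) :- z) refl z x ⟩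
    (z + x) - z   ≈⟨ +-congʳ eq ⟩
    (z + y) - z   ≈⟨ solve 2 (λ z y → (z :+ y) :- z := y) refl z y ⟩
    y             ∎)
    where open ≤-Reasoning

  +-nonneg : ∀ {x y} → 0# ≤ x → 0# ≤ y → 0# ≤ x + y
  +-nonneg 0≤x 0≤y = ≤-respˡ-≈ (+-identityˡ 0#) (+-mono-≤ 0≤x 0≤y)

  x<x+pos : ∀ x {e} → 0# < e → x < x + e
  x<x+pos x 0<e = ≤-<-trans (≤-reflexive (sym (+-identityʳ x))) (+-monoʳ-< x 0<e)

  *-monoˡ-≤ : ∀ {z x y} → 0# ≤ z → x ≤ y → z * x ≤ z * y
  *-monoˡ-≤ {z} {x} {y} 0≤z x≤y = ≤-from-difference (*-nonneg 0≤z (difference-nonneg x≤y))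
    (solve 3 (λ z x y → z :* (y :- x) := z :* y :- z :* x) refl z x y)

  *-monoʳ-≤ : ∀ {z x y} → 0# ≤ z → x ≤ y → x * z ≤ y * z
  *-monoʳ-≤ {z} {x} {y} 0≤z x≤y = ≤-from-difference (*-nonneg 0≤z (difference-nonneg x≤y))
    (solve 3 (λ z x y → z :* (y :- x) := y :* z :- x :* z) refl z x y)

  *-mono-≤ : ∀ {x y u v} → 0# ≤ x → 0# ≤ v → x ≤ y → u ≤ v → x * u ≤ y * v
  *-mono-≤ 0≤x 0≤v x≤y u≤v = ≤-trans (*-monoˡ-≤ 0≤x u≤v) (*-monoʳ-≤ 0≤v x≤y)

  square-nonneg : ∀ x → 0# ≤ x * x
  square-nonneg x with total 0# x
  ... | inj₁ 0≤x = *-nonneg 0≤x 0≤x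
  ... | inj₂ x≤0 = ≤-respʳ-≈ (solve 1 (λ x → (num 0 :- x) :* (num 0 :- x) := x :* x) refl x)
                     (*-nonneg (difference-nonneg x≤0) (difference-nonneg x≤0))

  0≤1 : 0# ≤ 1#
  0≤1 = ≤-respʳ-≈ (*-identityˡ 1#) (square-nonneg 1#)

  0<1 : 0# < 1#
  0<1 = 0≤1 , 1≉0 ∘ sym

  ⁻¹-inverseˡ : ∀ {x} → x ≉ 0# → x ⁻¹ * x ≈ 1#
  ⁻¹-inverseˡ {x} x≉0 = trans (*-comm (x ⁻¹) x) (⁻¹-inverseʳ x≉0)

  pos⇒≉0 : ∀ {x} → 0# < x → x ≉ 0#
  pos⇒≉0 0<x = proj₂ 0<x ∘ sym

  *-cancelˡ-≈0 : ∀ {x y} → x ≉ 0# → x * y ≈ 0# → y ≈ 0#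
  *-cancelˡ-≈0 {x} {y} x≉0 xy≈0 = begin-equality
    y                ≈⟨ *-identityˡ y ⟨
    1# * y           ≈⟨ *-congʳ (⁻¹-inverseˡ x≉0) ⟨
    x ⁻¹ * x * y     ≈⟨ *-assoc _ _ _ ⟩
    x ⁻¹ * (x * y)   ≈⟨ *-congˡ xy≈0 ⟩
    x ⁻¹ * 0#        ≈⟨ zeroʳ _ ⟩
    0#               ∎
    where open ≤-Reasoning

  *-pos : ∀ {x y} → 0# < x → 0# < y → 0# < x * y
  *-pos 0<x 0<y = *-nonneg (<⇒≤ 0<x) (<⇒≤ 0<y) , λ 0≈xy →
    pos⇒≉0 0<y (*-cancelˡ-≈0 (pos⇒≉0 0<x) (sym 0≈xy))

  ⁻¹-pos : ∀ {x} → 0# < x → 0# < x ⁻¹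
  ⁻¹-pos {x} 0<x = ≰⇒> λ x⁻¹≤0 → <⇒≱ 0<1 (begin
    1#         ≈⟨ ⁻¹-inverseʳ (pos⇒≉0 0<x) ⟨
    x * x ⁻¹   ≤⟨ *-monoˡ-≤ (<⇒≤ 0<x) x⁻¹≤0 ⟩
    x * 0#     ≈⟨ zeroʳ x ⟩
    0#         ∎)
    where open ≤-Reasoning

  *-monoˡ-< : ∀ {z x y} → 0# < z → x < y → z * x < z * y
  *-monoˡ-< {z} {x} {y} 0<z x<y = *-monoˡ-≤ (<⇒≤ 0<z) (<⇒≤ x<y) , λ eq →
    pos⇒≉0 (*-pos 0<z (difference-pos x<y)) (begin-equality
      z * (y - x)     ≈⟨ solve 3 (λ z x y → z :* (y :- x) := z :* y :- z :* x) refl z x y ⟩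
      z * y - z * x   ≈⟨ +-congˡ (-‿cong eq) ⟩
      z * y - z * y   ≈⟨ -‿inverseʳ _ ⟩
      0#              ∎)
    where open ≤-Reasoning

  *-cancelˡ-≤ : ∀ {z x y} → 0# < z → z * x ≤ z * y → x ≤ y
  *-cancelˡ-≤ 0<z zx≤zy = ≮⇒≥ λ y<x → <⇒≱ (*-monoˡ-< 0<z y<x) zx≤zy

  x/y*y≈x : ∀ x {y} → y ≉ 0# → x / y * y ≈ x
  x/y*y≈x x {y} y≉0 = trans (*-assoc x (y ⁻¹) y)
    (trans (*-congˡ (⁻¹-inverseˡ y≉0)) (*-identityʳ x))

  /-pos : ∀ {x y} → 0# < x → 0# < y → 0# < x / y
  /-pos 0<x 0<y = *-pos 0<x (⁻¹-pos 0<y)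

  ≤-*⇒/-≤ : ∀ {x y z} → 0# < y → x ≤ z * y → x / y ≤ z
  ≤-*⇒/-≤ {x} {y} {z} 0<y x≤zy = *-cancelˡ-≤ 0<y (begin
    y * (x / y)   ≈⟨ *-comm _ _ ⟩
    x / y * y     ≈⟨ x/y*y≈x x (pos⇒≉0 0<y) ⟩
    x             ≤⟨ x≤zy ⟩
    z * y         ≈⟨ *-comm _ _ ⟩
    y * z         ∎)
    where open ≤-Reasoning

  -- Natural multiples and powers

  fromℕ-nonneg : ∀ n → 0# ≤ fromℕ n
  fromℕ-nonneg zero    = ≤-refl
  fromℕ-nonneg (suc n) = +-nonneg 0≤1 (fromℕ-nonneg n)

  fromℕ-pos : ∀ n → 0# < fromℕ (suc n)
  fromℕ-pos n = <-≤-trans 0<1 (≤-respˡ-≈ (+-identityʳ 1#) (+-monoʳ-≤ 1# (fromℕ-nonneg n)))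

  fromℕ-mono-≤ : ∀ {m n} → m ℕ.≤ n → fromℕ m ≤ fromℕ n
  fromℕ-mono-≤ {n = n} z≤n = fromℕ-nonneg n
  fromℕ-mono-≤ (s≤s m≤n)   = +-monoʳ-≤ 1# (fromℕ-mono-≤ m≤n)

  fromℕ-<-suc : ∀ n → fromℕ n < fromℕ (suc n)
  fromℕ-<-suc n = <-≤-trans (x<x+pos (fromℕ n) 0<1) (≤-reflexive (+-comm _ _))

  fromℕ-cancel-≤ : ∀ {m n} → fromℕ m ≤ fromℕ n → m ℕ.≤ n
  fromℕ-cancel-≤ {m} {n} fm≤fn = ℕ.≮⇒≥ λ n<m →
    <⇒≱ (fromℕ-<-suc n) (≤-trans (fromℕ-mono-≤ n<m) fm≤fn)

  fromℕ-cancel-< : ∀ {m n} → fromℕ m < fromℕ n → m ℕ.< n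
  fromℕ-cancel-< fm<fn = ℕ.≰⇒> (<⇒≱ fm<fn ∘ fromℕ-mono-≤)

  fromℕ-homo-* : ∀ m n → fromℕ (m ℕ.* n) ≈ fromℕ m * fromℕ n
  fromℕ-homo-* = ×1-homo-*

  fromℕ-homo-+ : ∀ m n → fromℕ (m ℕ.+ n) ≈ fromℕ m + fromℕ n
  fromℕ-homo-+ = ×-homo-+ 1#

  fromℕ-homo-^ : ∀ m k → fromℕ (m ℕ.^ k) ≈ fromℕ m ^ k
  fromℕ-homo-^ m zero    = +-identityʳ 1#
  fromℕ-homo-^ m (suc k) = trans (fromℕ-homo-* m (m ℕ.^ k)) (*-congˡ (fromℕ-homo-^ m k))

  ^-nonneg : ∀ {x} n → 0# ≤ x → 0# ≤ x ^ n
  ^-nonneg zero    0≤x = 0≤1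
  ^-nonneg (suc n) 0≤x = *-nonneg 0≤x (^-nonneg n 0≤x)

  ^-pos : ∀ {x} n → 0# < x → 0# < x ^ n
  ^-pos zero    0<x = 0<1
  ^-pos (suc n) 0<x = *-pos 0<x (^-pos n 0<x)

  ^-monoˡ-≤ : ∀ {x y} n → 0# ≤ x → x ≤ y → x ^ n ≤ y ^ n
  ^-monoˡ-≤ zero    0≤x x≤y = ≤-refl
  ^-monoˡ-≤ (suc n) 0≤x x≤y =
    *-mono-≤ 0≤x (^-nonneg n (≤-trans 0≤x x≤y)) x≤y (^-monoˡ-≤ n 0≤x x≤y)

  ^-monoˡ-< : ∀ {x y} n → 0# ≤ x → x < y → x ^ suc n < y ^ suc n
  ^-monoˡ-< {x} {y} n 0≤x x<y = begin-strict
    x * x ^ n   ≤⟨ *-monoˡ-≤ 0≤x (^-monoˡ-≤ n 0≤x (<⇒≤ x<y)) ⟩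
    x * y ^ n   ≈⟨ *-comm _ _ ⟩
    y ^ n * x   <⟨ *-monoˡ-< (^-pos n (≤-<-trans 0≤x x<y)) x<y ⟩
    y ^ n * y   ≈⟨ *-comm _ _ ⟩
    y * y ^ n   ∎
    where open ≤-Reasoning

  ^-cancelˡ-≤ : ∀ {x y} n → 0# ≤ y → x ^ suc n ≤ y ^ suc n → x ≤ y
  ^-cancelˡ-≤ n 0≤y xⁿ≤yⁿ = ≮⇒≥ λ y<x → <⇒≱ (^-monoˡ-< n 0≤y y<x) xⁿ≤yⁿ

  ^-cancelˡ-< : ∀ {x y} n → 0# ≤ x → 0# ≤ y → x ^ suc n < y ^ suc n → x < y
  ^-cancelˡ-< n 0≤x 0≤y xⁿ<yⁿ = ≰⇒> λ y≤x → <⇒≱ xⁿ<yⁿ (^-monoˡ-≤ (suc n) 0≤y y≤x)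

  1^n≈1 : ∀ n → 1# ^ n ≈ 1#
  1^n≈1 zero    = refl
  1^n≈1 (suc n) = trans (*-identityˡ _) (1^n≈1 n)

  1≤x^n : ∀ {x} n → 1# ≤ x → 1# ≤ x ^ n
  1≤x^n n 1≤x = ≤-respˡ-≈ (1^n≈1 n) (^-monoˡ-≤ n 0≤1 1≤x)

  ^-monoʳ-≤ : ∀ {x m n} → 1# ≤ x → m ℕ.≤ n → x ^ m ≤ x ^ n
  ^-monoʳ-≤ {x} {n = n} 1≤x z≤n = 1≤x^n n 1≤x
  ^-monoʳ-≤ 1≤x (s≤s m≤n) = *-monoˡ-≤ (≤-trans 0≤1 1≤x) (^-monoʳ-≤ 1≤x m≤n)

  bernoulli : ∀ {e} n → 0# ≤ e → 1# + fromℕ n * e ≤ (1# + e) ^ n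
  bernoulli {e} zero    0≤e = ≤-reflexive (solve 1 (λ e → num 1 :+ num 0 :* e := num 1) refl e)
  bernoulli {e} (suc n) 0≤e = begin
    1# + (1# + N) * e
        ≤⟨ ≤-from-difference (*-nonneg (fromℕ-nonneg n) (square-nonneg e))
           (solve 2 (λ N e → N :* (e :* e) := (num 1 :+ e) :* (num 1 :+ N :* e)
                     :- (num 1 :+ (num 1 :+ N) :* e)) refl N e) ⟩
    (1# + e) * (1# + N * e)   ≤⟨ *-monoˡ-≤ (+-nonneg 0≤1 0≤e) (bernoulli n 0≤e) ⟩
    (1# + e) * (1# + e) ^ n   ∎
    where
    open ≤-Reasoning
    N = fromℕ n

  fromℕ2≈2 : fromℕ 2 ≈ 2#
  fromℕ2≈2 = solve 0 (num 1 :+ (num 1 :+ num 0) := num 2) refl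

  1≤fromℕ2 : 1# ≤ fromℕ 2
  1≤fromℕ2 = ≤-respˡ-≈ (+-identityʳ 1#) (fromℕ-mono-≤ (s≤s (z≤n {1})))

  fromℕ-≤-2^ : ∀ n → fromℕ n ≤ fromℕ 2 ^ n
  fromℕ-≤-2^ n = begin
    fromℕ n             ≤⟨ <⇒≤ (fromℕ-<-suc n) ⟩
    1# + fromℕ n        ≈⟨ +-congˡ (*-identityʳ _) ⟨
    1# + fromℕ n * 1#   ≤⟨ bernoulli n 0≤1 ⟩
    (1# + 1#) ^ n       ≈⟨ ^-congˡ n fromℕ2≈2 ⟨
    fromℕ 2 ^ n         ∎
    where open ≤-Reasoning

  -- The Archimedean property and integer parts

  archimedean : ∀ x → ∃ λ n → x < fromℕ n
  archimedean x with em {P = ∃ λ n → x < fromℕ n}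
  ... | yes p = p
  ... | no ¬p = ⊥-elim (<⇒≱ (x<x+pos (s - 1#) 0<1) (begin
      (s - 1#) + 1#   ≈⟨ solve 1 (λ s → (s :- num 1) :+ num 1 := s) refl s ⟩
      s               ≤⟨ proj₂ (proj₂ sup) (s - 1#) s-1-upper ⟩
      s - 1#          ∎))
    where
    open ≤-Reasoning
    P : ℝ → Set
    P y = ∃ λ n → y ≈ fromℕ n
    upper : IsUpperBound _≤_ P x
    upper y (n , y≈) = ≤-respˡ-≈ (sym y≈) (≮⇒≥ λ x<n → ¬p (n , x<n))
    sup = supremum P (0# , 0 , refl) (x , upper)
    s = proj₁ sup
    -- The successor of a natural number is again bounded by `s`, so the supremum of the naturals
    -- could be lowered by 1.
    s-1-upper : IsUpperBound _≤_ P (s - 1#)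
    s-1-upper y (n , y≈) = begin
      y                    ≈⟨ y≈ ⟩
      fromℕ n              ≈⟨ solve 1 (λ y → y := (num 1 :+ y) :- num 1) refl _ ⟩
      fromℕ (suc n) - 1#   ≤⟨ ≤-respˡ-≈ (+-comm _ _) (≤-respʳ-≈ (+-comm _ _)
                                (+-monoʳ-≤ (- 1#) (proj₁ (proj₂ sup) _ (suc n , refl)))) ⟩
      s - 1#               ∎

  last : (P : ℕ → Set) → P 0 → ∀ n → ¬ P n → ∃ λ m → P m × ¬ P (suc m)
  last P p0 zero    ¬pn = contradiction p0 ¬pn
  last P p0 (suc n) ¬pn with em {P = P n}
  ... | yes pn = n , pn , ¬pn
  ... | no ¬pn′ = last P p0 n ¬pn′

  floor : ∀ {x} → 0# ≤ x → ∃ λ n → fromℕ n ≤ x × x < fromℕ (suc n)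
  floor {x} 0≤x =
    let N , x<N = archimedean x
        n , n≤x , ¬1+n≤x = last (λ n → fromℕ n ≤ x) 0≤x N (<⇒≱ x<N)
    in n , n≤x , ≰⇒> ¬1+n≤x

  floorLog₂ : ∀ {x} → 1# ≤ x → ∃ λ n → fromℕ 2 ^ n ≤ x × x < fromℕ 2 ^ suc n
  floorLog₂ {x} 1≤x =
    let N , x<N = archimedean x
        n , n≤x , ¬1+n≤x = last (λ n → fromℕ 2 ^ n ≤ x) 1≤x N (<⇒≱ (<-≤-trans x<N (fromℕ-≤-2^ N)))
    in n , n≤x , ≰⇒> ¬1+n≤x

  -- Roots

  -- Continuity of the power map in the form that root extraction uses. The constant is uniform in
  -- `a`, because `^-decrease` applies the estimate at a point that is chosen only after `K`.
  ^-locallyLipschitz : ∀ M → 0# ≤ M → ∀ n → ∃ λ K → 0# ≤ K ×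
    (∀ a e → 0# ≤ a → a ≤ M → 0# ≤ e → e ≤ 1# → (a + e) ^ n ≤ a ^ n + e * K)
  ^-locallyLipschitz M 0≤M zero = 0# , ≤-refl , λ a e _ _ _ _ →
    ≤-reflexive (solve 1 (λ e → num 1 := num 1 :+ e :* num 0) refl e)
  ^-locallyLipschitz M 0≤M (suc n) =
    let K , 0≤K , lip = ^-locallyLipschitz M 0≤M n
    in M ^ n + M * K + K
     , +-nonneg (+-nonneg (^-nonneg n 0≤M) (*-nonneg 0≤M 0≤K)) 0≤K
     , λ a e 0≤a a≤M 0≤e e≤1 → begin
         (a + e) * (a + e) ^ n
             ≤⟨ *-monoˡ-≤ (+-nonneg 0≤a 0≤e) (lip a e 0≤a a≤M 0≤e e≤1) ⟩
         (a + e) * (a ^ n + e * K)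
             ≈⟨ solve 4 (λ a e p K → (a :+ e) :* (p :+ e :* K) :=
                a :* p :+ e :* (p :+ a :* K :+ e :* K)) refl a e (a ^ n) K ⟩
         a * a ^ n + e * (a ^ n + a * K + e * K)
             ≤⟨ +-monoʳ-≤ _ (*-monoˡ-≤ 0≤e (+-mono-≤ (+-mono-≤
                (^-monoˡ-≤ n 0≤a a≤M) (*-monoʳ-≤ 0≤K a≤M))
                (≤-respʳ-≈ (*-identityˡ K) (*-monoʳ-≤ 0≤K e≤1)))) ⟩
         a * a ^ n + e * (M ^ n + M * K + K)  ∎
    where open ≤-Reasoning

  -- The denominator `g + K` dominates both `g` and `K`, and it is positive even if `K` vanishes, so
  -- one quotient meets both bounds.
  ∃-small : ∀ {g K} → 0# < g → 0# ≤ K → ∃ λ e → 0# < e × e ≤ 1# × e * K ≤ g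
  ∃-small {g} {K} 0<g 0≤K = g / D , /-pos 0<g 0<D , ≤-*⇒/-≤ 0<D g≤1*D , (begin
    g / D * K   ≤⟨ *-monoˡ-≤ (<⇒≤ (/-pos 0<g 0<D)) K≤D ⟩
    g / D * D   ≈⟨ x/y*y≈x g (pos⇒≉0 0<D) ⟩
    g           ∎)
    where
    open ≤-Reasoning
    D = g + K
    g≤D : g ≤ D
    g≤D = ≤-from-difference 0≤K (solve 2 (λ g K → K := (g :+ K) :- g) refl g K)
    K≤D : K ≤ D
    K≤D = ≤-from-difference (<⇒≤ 0<g) (solve 2 (λ g K → g := (g :+ K) :- K) refl g K)
    0<D = <-≤-trans 0<g g≤D
    g≤1*D = ≤-respʳ-≈ (sym (*-identityˡ D)) g≤D

  ^-increase : ∀ {s c} n → 0# ≤ s → s ^ n < c → ∃ λ r → s < r × r ^ n ≤ c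
  ^-increase {s} {c} n 0≤s sⁿ<c =
    let K , 0≤K , lip = ^-locallyLipschitz s 0≤s n
        e , 0<e , e≤1 , eK≤g = ∃-small (difference-pos sⁿ<c) 0≤K
    in s + e , x<x+pos s 0<e , (begin
      (s + e) ^ n           ≤⟨ lip s e 0≤s ≤-refl (<⇒≤ 0<e) e≤1 ⟩
      s ^ n + e * K         ≤⟨ +-monoʳ-≤ (s ^ n) eK≤g ⟩
      s ^ n + (c - s ^ n)   ≈⟨ solve 2 (λ p c → p :+ (c :- p) := c) refl (s ^ n) c ⟩
      c                     ∎)
    where open ≤-Reasoning

  ^-decrease : ∀ {s c} n → 0# < s → c < s ^ n → ∃ λ r → 0# ≤ r × r < s × c ≤ r ^ n
  ^-decrease {s} {c} n 0<s c<sⁿ =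
    let K , 0≤K , lip = ^-locallyLipschitz s (<⇒≤ 0<s) n
        e , 0<e , e≤1 , eK≤g = ∃-small (difference-pos c<sⁿ) 0≤K
        -- The second factor brings the decrement `e * f` below `s`, which keeps `r` nonnegative.
        f , 0<f , f≤1 , f≤s = ∃-small 0<s 0≤1
        h = e * f
        r = s - h
        0<h = *-pos 0<e 0<f
        h≤e = ≤-respʳ-≈ (*-identityʳ e) (*-monoˡ-≤ (<⇒≤ 0<e) f≤1)
        h≤s = ≤-trans (≤-respʳ-≈ (*-comm 1# f) (*-monoʳ-≤ (<⇒≤ 0<f) e≤1)) f≤s
        0≤r = difference-nonneg h≤s
        r+h≈s = solve 2 (λ s h → (s :- h) :+ h := s) refl s h
        r<s = <-≤-trans (x<x+pos r 0<h) (≤-reflexive r+h≈s)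
        sⁿ≤ = begin
          s ^ n                 ≈⟨ ^-congˡ n r+h≈s ⟨
          (r + h) ^ n           ≤⟨ lip r h 0≤r (<⇒≤ r<s) (<⇒≤ 0<h) (≤-trans h≤e e≤1) ⟩
          r ^ n + h * K         ≤⟨ +-monoʳ-≤ (r ^ n) (≤-trans (*-monoʳ-≤ 0≤K h≤e) eK≤g) ⟩
          r ^ n + (s ^ n - c)   ∎
    in r , 0≤r , r<s , ≤-from-difference (difference-nonneg sⁿ≤)
         (solve 3 (λ p q c → (q :+ (p :- c)) :- p := q :- c) refl (s ^ n) (r ^ n) c)
    where open ≤-Reasoning

  -- For `c` below 1 the root exceeds `c`; the base `1# + c` is at least 1, so its powers do not
  -- fall below it.
  root-bound : ∀ n {c y} → 0# ≤ c → y ^ suc n ≤ c → y ≤ 1# + c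
  root-bound n {c} {y} 0≤c yⁿ≤c = ^-cancelˡ-≤ n 0≤1+c (begin
    y ^ suc n                 ≤⟨ yⁿ≤c ⟩
    c                         ≤⟨ <⇒≤ (x<x+pos c 0<1) ⟩
    c + 1#                    ≈⟨ +-comm c 1# ⟩
    1# + c                    ≈⟨ *-identityʳ _ ⟨
    (1# + c) * 1#             ≤⟨ *-monoˡ-≤ 0≤1+c (1≤x^n n 1≤1+c) ⟩
    (1# + c) * (1# + c) ^ n   ∎)
    where
    open ≤-Reasoning
    1≤1+c : 1# ≤ 1# + c
    1≤1+c = ≤-respˡ-≈ (+-identityʳ 1#) (+-monoʳ-≤ 1# 0≤c)
    0≤1+c : 0# ≤ 1# + c
    0≤1+c = ≤-trans 0≤1 1≤1+c

  ∃-root : ∀ n {c} → 0# ≤ c → ∃ λ s → 0# ≤ s × s ^ suc n ≈ c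
  ∃-root n {c} 0≤c =
    let s , s-upper , s-least = supremum P (0# , P-0) (1# + c , λ y p → root-bound n 0≤c (proj₂ p))
        0≤s = s-upper 0# P-0
    in s , 0≤s , antisym (≮⇒≥ (not-above s 0≤s s-least)) (≮⇒≥ (not-below s 0≤s s-upper))
    where
    P : ℝ → Set
    P y = 0# ≤ y × y ^ suc n ≤ c
    P-0 : P 0#
    P-0 = ≤-refl , ≤-respˡ-≈ (sym (zeroˡ _)) 0≤c
    not-below : ∀ s → 0# ≤ s → IsUpperBound _≤_ P s → ¬ s ^ suc n < c
    not-below s 0≤s s-upper sⁿ<c = let r , s<r , rⁿ≤c = ^-increase (suc n) 0≤s sⁿ<c in
      <⇒≱ s<r (s-upper r (≤-trans 0≤s (<⇒≤ s<r) , rⁿ≤c))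
    not-above : ∀ s → 0# ≤ s → (∀ b → IsUpperBound _≤_ P b → s ≤ b) → ¬ c < s ^ suc n
    not-above s 0≤s s-least c<sⁿ =
      let 0<s = 0≤s , λ 0≈s → <⇒≱ c<sⁿ (≤-respˡ-≈ (trans (sym (zeroˡ _)) (*-congʳ 0≈s)) 0≤c)
          r , 0≤r , r<s , c≤rⁿ = ^-decrease (suc n) 0<s c<sⁿ
      in <⇒≱ r<s (s-least r λ y p → ^-cancelˡ-≤ n 0≤r (≤-trans (proj₂ p) c≤rⁿ))

  ∃-√ : ∀ {x} → 0# ≤ x → ∃ λ s → 0# ≤ s × s * s ≈ x
  ∃-√ 0≤x = let s , 0≤s , s²≈x = ∃-root 1 0≤x in s , 0≤s , trans (*-congˡ (sym (*-identityʳ s))) s²≈x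

  the-spec : ∀ {P : ℝ → Set} → ∃ P → P (the P)
  the-spec {P} ∃P with em {P = ∃ P}
  ... | yes (_ , p) = p
  ... | no ¬∃P      = ⊥-elim (¬∃P ∃P)

  √-spec : ∀ {x} → 0# ≤ x → 0# ≤ √ x × √ x * √ x ≈ x
  √-spec 0≤x = the-spec (∃-√ 0≤x)

  -- Rational powers and logarithms to base 2

  -- This says a = 2^(m/(n+1)) and unfolds to the same type as
  -- `IsRationalPowerOf2 (mkℚᵘ (+ m) n) a`. Nonnegative exponents suffice to approximate numbers
  -- from 1 upwards.
  Root : ℕ → ℕ → ℝ → Set
  Root m n a = 0# ≤ a × a ^ suc n ≈ fromℕ 2 ^ m

  frac : ℕ → ℕ → ℝ
  frac m n = fromℕ m / fromℕ (suc n)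

  0<2 : 0# < fromℕ 2
  0<2 = fromℕ-pos 1

  frac-≤⇒*-≤ : ∀ {m n m′ n′} → frac m n ≤ frac m′ n′ → m ℕ.* suc n′ ℕ.≤ m′ ℕ.* suc n
  frac-≤⇒*-≤ {m} {n} {m′} {n′} q≤q′ = fromℕ-cancel-≤ (begin
    fromℕ (m ℕ.* suc n′)   ≈⟨ fromℕ-homo-* m (suc n′) ⟩
    fromℕ m * N′           ≈⟨ *-congʳ (x/y*y≈x _ (pos⇒≉0 (fromℕ-pos n))) ⟨
    frac m n * N * N′
        ≤⟨ *-monoʳ-≤ (fromℕ-nonneg (suc n′)) (*-monoʳ-≤ (fromℕ-nonneg (suc n)) q≤q′) ⟩
    frac m′ n′ * N * N′
        ≈⟨ solve 3 (λ q N N′ → q :* N :* N′ := q :* N′ :* N) refl (frac m′ n′) N N′ ⟩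
    frac m′ n′ * N′ * N    ≈⟨ *-congʳ (x/y*y≈x _ (pos⇒≉0 (fromℕ-pos n′))) ⟩
    fromℕ m′ * N           ≈⟨ fromℕ-homo-* m′ (suc n) ⟨
    fromℕ (m′ ℕ.* suc n)   ∎)
    where
    open ≤-Reasoning
    N = fromℕ (suc n)
    N′ = fromℕ (suc n′)

  -- Raising to the common power (n+1)(n′+1) turns both sides into integer powers of 2, whose
  -- exponents are compared by cross-multiplication.
  Root-mono : ∀ {m n a m′ n′ a′} → Root m n a → Root m′ n′ a′ → frac m n ≤ frac m′ n′ → a ≤ a′
  Root-mono {m} {n} {a} {m′} {n′} {a′} (0≤a , aⁿ≈) (0≤a′ , a′ⁿ≈) q≤q′ =
    -- The argument is the predecessor of `suc n ℕ.* suc n′`.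
    ^-cancelˡ-≤ (n′ ℕ.+ n ℕ.* suc n′) 0≤a′ (begin
      a ^ (suc n ℕ.* suc n′)     ≈⟨ ^-assocʳ a (suc n) (suc n′) ⟨
      (a ^ suc n) ^ suc n′       ≈⟨ ^-congˡ (suc n′) aⁿ≈ ⟩
      (fromℕ 2 ^ m) ^ suc n′     ≈⟨ ^-assocʳ (fromℕ 2) m (suc n′) ⟩
      fromℕ 2 ^ (m ℕ.* suc n′)   ≤⟨ ^-monoʳ-≤ 1≤fromℕ2 (frac-≤⇒*-≤ {m} {n} {m′} {n′} q≤q′) ⟩
      fromℕ 2 ^ (m′ ℕ.* suc n)   ≈⟨ ^-assocʳ (fromℕ 2) m′ (suc n) ⟨
      (fromℕ 2 ^ m′) ^ suc n     ≈⟨ ^-congˡ (suc n) a′ⁿ≈ ⟨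
      (a′ ^ suc n′) ^ suc n      ≈⟨ ^-assocʳ a′ (suc n′) (suc n) ⟩
      a′ ^ (suc n′ ℕ.* suc n)    ≡⟨ ≡.cong (a′ ^_) (ℕ.*-comm (suc n′) (suc n)) ⟩
      a′ ^ (suc n ℕ.* suc n′)    ∎)
    where open ≤-Reasoning

  Root-reflects-< : ∀ {m n a m′ n′ a′} → Root m n a → Root m′ n′ a′ → a < a′ → frac m n < frac m′ n′
  Root-reflects-< {m} {n} {a} {m′} {n′} {a′} r r′ a<a′ =
    ≰⇒> (<⇒≱ a<a′ ∘ Root-mono {m′} {n′} {a′} {m} {n} {a} r′ r)

  -- Once xⁿ⁺¹ exceeds 2 bⁿ⁺¹, the largest power of 2 below xⁿ⁺¹ lies above bⁿ⁺¹, since its double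
  -- is at least xⁿ⁺¹. Its root of order n + 1 is then between `b` and `x`.
  Root-dense : ∀ {b x} → 1# ≤ b → b < x → ∃ λ m → ∃ λ n → ∃ λ a → Root m n a × b < a × a < x
  Root-dense {b} {x} 1≤b b<x =
    let n , 2bⁿ<xⁿ = doubling
        N , xⁿ<N = archimedean (x ^ suc n)
        m , 2ᵐ<xⁿ , 2ᵐ⁺¹≮xⁿ = last (λ m → fromℕ 2 ^ m < x ^ suc n)
          (≤-<-trans (≤-reflexive (sym (1^n≈1 (suc n)))) (^-monoˡ-< n 0≤1 1<x)) N
          λ lt → <⇒≱ lt (≤-trans (<⇒≤ xⁿ<N) (fromℕ-≤-2^ N))
        a , 0≤a , aⁿ≈ = ∃-root n (^-nonneg m (<⇒≤ 0<2))
        2bⁿ<2aⁿ = <-≤-trans 2bⁿ<xⁿ (≤-trans (≮⇒≥ 2ᵐ⁺¹≮xⁿ) (*-monoˡ-≤ (<⇒≤ 0<2) (≤-reflexive (sym aⁿ≈))))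
    in m , n , a , (0≤a , aⁿ≈)
     , ^-cancelˡ-< n (<⇒≤ 0<b) 0≤a (*-cancelˡ-< 0<2 2bⁿ<2aⁿ)
     , ^-cancelˡ-< n 0≤a (≤-trans 0≤1 (<⇒≤ 1<x)) (≤-<-trans (≤-reflexive aⁿ≈) 2ᵐ<xⁿ)
    where
    open ≤-Reasoning
    0<b : 0# < b
    0<b = <-≤-trans 0<1 1≤b
    1<x : 1# < x
    1<x = ≤-<-trans 1≤b b<x
    *-cancelˡ-< : ∀ {z x y} → 0# < z → z * x < z * y → x < y
    *-cancelˡ-< 0<z zx<zy = ≰⇒> λ y≤x → <⇒≱ zx<zy (*-monoˡ-≤ (<⇒≤ 0<z) y≤x)
    e : ℝ
    e = (x - b) / b
    0<e : 0# < e
    0<e = /-pos (difference-pos b<x) 0<b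
    b[1+e]≈x : (1# + e) * b ≈ x
    b[1+e]≈x = begin-equality
      (1# + e) * b   ≈⟨ solve 2 (λ e b → (num 1 :+ e) :* b := b :+ e :* b) refl e b ⟩
      b + e * b      ≈⟨ +-congˡ (x/y*y≈x _ (pos⇒≉0 0<b)) ⟩
      b + (x - b)    ≈⟨ solve 2 (λ x b → b :+ (x :- b) := x) refl x b ⟩
      x              ∎
    -- With x = (1 + e) b it suffices that (1 + e)ⁿ⁺¹ > 2, and Bernoulli's inequality gives this as
    -- soon as (n + 1) e > 1.
    doubling : ∃ λ n → fromℕ 2 * b ^ suc n < x ^ suc n
    doubling = let n , e⁻¹<n = archimedean (e ⁻¹) in n , (begin-strict
      fromℕ 2 * b ^ suc n            ≈⟨ *-comm _ _ ⟩
      b ^ suc n * fromℕ 2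
          <⟨ *-monoˡ-< (^-pos (suc n) 0<b) (begin-strict
             fromℕ 2                  ≈⟨ fromℕ2≈2 ⟩
             1# + 1#                  ≈⟨ +-congˡ (⁻¹-inverseʳ (pos⇒≉0 0<e)) ⟨
             1# + e * e ⁻¹
                 <⟨ +-monoʳ-< 1# (*-monoˡ-< 0<e (≤-<-trans (<⇒≤ e⁻¹<n) (fromℕ-<-suc n))) ⟩
             1# + e * fromℕ (suc n)   ≈⟨ +-congˡ (*-comm e (fromℕ (suc n))) ⟩
             1# + fromℕ (suc n) * e   ≤⟨ bernoulli (suc n) (<⇒≤ 0<e) ⟩
             (1# + e) ^ suc n         ∎) ⟩
      b ^ suc n * (1# + e) ^ suc n   ≈⟨ *-comm _ _ ⟩
      (1# + e) ^ suc n * b ^ suc n   ≈⟨ ^-distrib-* (1# + e) b (suc n) ⟨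
      ((1# + e) * b) ^ suc n         ≈⟨ ^-congˡ (suc n) b[1+e]≈x ⟩
      x ^ suc n                      ∎)

  -neg : ∀ {x} → 0# ≤ x → - x ≤ 0#
  -neg {x} 0≤x = ≤-from-difference 0≤x (solve 1 (λ x → x := num 0 :- (:- x)) refl x)

  negative-power-root : ∀ {m n a} → IsRationalPowerOf2 (mkℚᵘ -[1+ m ] n) a →
                        fromℕ 2 ^ suc m * a ^ suc n ≈ 1#
  negative-power-root {m} (_ , aⁿ≈) = trans (*-congˡ aⁿ≈) (⁻¹-inverseʳ (pos⇒≉0 (^-pos (suc m) 0<2)))

  negative-power-≤1 : ∀ {m n a} → IsRationalPowerOf2 (mkℚᵘ -[1+ m ] n) a → a ≤ 1#
  negative-power-≤1 {m} {n} {a} r@(0≤a , _) = ^-cancelˡ-≤ n 0≤1 (begin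
    a ^ suc n                     ≈⟨ *-identityˡ _ ⟨
    1# * a ^ suc n                ≤⟨ *-monoʳ-≤ (^-nonneg (suc n) 0≤a) (1≤x^n (suc m) 1≤fromℕ2) ⟩
    fromℕ 2 ^ suc m * a ^ suc n   ≈⟨ negative-power-root {m} {n} r ⟩
    1#                            ≈⟨ 1^n≈1 (suc n) ⟨
    1# ^ suc n                    ∎)
    where open ≤-Reasoning

  negative-power-≤½ : ∀ {m n a} → IsRationalPowerOf2 (mkℚᵘ -[1+ m ] n) a →
                      suc n ℕ.≤ suc m → fromℕ 2 * a ≤ 1#
  negative-power-≤½ {m} {n} {a} r@(0≤a , _) n≤m = ^-cancelˡ-≤ n 0≤1 (begin
    (fromℕ 2 * a) ^ suc n         ≈⟨ ^-distrib-* (fromℕ 2) a (suc n) ⟩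
    fromℕ 2 ^ suc n * a ^ suc n   ≤⟨ *-monoʳ-≤ (^-nonneg (suc n) 0≤a) (^-monoʳ-≤ 1≤fromℕ2 n≤m) ⟩
    fromℕ 2 ^ suc m * a ^ suc n   ≈⟨ negative-power-root {m} {n} r ⟩
    1#                            ≈⟨ 1^n≈1 (suc n) ⟨
    1# ^ suc n                    ∎)
    where open ≤-Reasoning

  -- The suprema behind `exp₂` and `log₂`

  PowerBelow : ℝ → ℝ → Set
  PowerBelow y a = Σ ℚᵘ λ q → fromℚ q ≤ y × IsRationalPowerOf2 q a

  Sup : (ℝ → Set) → ℝ → Set
  Sup = IsSupremum _≤_

  Sup-unique : ∀ {P s t} → Sup P s → Sup P t → s ≈ t
  Sup-unique (s-upper , s-least) (t-upper , t-least) = antisym (s-least _ t-upper) (t-least _ s-upper)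

  -- The supremum of this set is log₂ x.
  LogSet : ℝ → ℝ → Set
  LogSet x r = ∃ λ m → ∃ λ n → ∃ λ a → Root m n a × a ≤ x × r ≈ frac m n

  Root-1 : Root 0 0 1#
  Root-1 = 0≤1 , *-identityˡ 1#

  Root-integer : ∀ k → Root k 0 (fromℕ 2 ^ k)
  Root-integer k = ^-nonneg k (<⇒≤ 0<2) , *-identityʳ _

  frac-0 : ∀ k → frac k 0 ≈ fromℕ k
  frac-0 k = begin-equality
    frac k 0             ≈⟨ *-identityʳ _ ⟨
    frac k 0 * 1#        ≈⟨ *-congˡ (+-identityʳ 1#) ⟨
    frac k 0 * fromℕ 1   ≈⟨ x/y*y≈x _ (pos⇒≉0 (fromℕ-pos 0)) ⟩
    fromℕ k              ∎
    where open ≤-Reasoning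

  LogSet-bounded : ∀ {x} → 1# ≤ x → ∃ (IsUpperBound _≤_ (LogSet x))
  LogSet-bounded {x} 1≤x =
    let k , x<k = archimedean x
    in frac k 0 , λ { r (m , n , a , root , a≤x , r≈) → ≤-respˡ-≈ (sym r≈)
         (<⇒≤ (Root-reflects-< {m} {n} {a} {k} {0} root (Root-integer k)
           (≤-<-trans a≤x (<-≤-trans x<k (fromℕ-≤-2^ k))))) }

  -- Density is used on either side of `x`. A power `a` above `x` would leave room for a rational
  -- power in between, whose exponent bounds `LogSet x` and hence `y`, yet is smaller than that of
  -- `a`. A bound `b` below `x` would be passed by a rational power below `x`, whose exponent is at
  -- most `y`.
  Sup-LogSet⇒Sup-PowerBelow : ∀ {x y} → 1# ≤ x → Sup (LogSet x) y → Sup (PowerBelow y) x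
  Sup-LogSet⇒Sup-PowerBelow {x} {y} 1≤x (y-upper , y-least) = upper , least
    where
    upper : IsUpperBound _≤_ (PowerBelow y) x
    upper a (mkℚᵘ -[1+ m ] n , q≤y , r) = ≤-trans (negative-power-≤1 {m} {n} r) 1≤x
    upper a (mkℚᵘ (+ m) n , q≤y , r) = ≮⇒≥ λ x<a →
      let m′ , n′ , a′ , r′ , x<a′ , a′<a = Root-dense 1≤x x<a
          y≤q′ = y-least (frac m′ n′) λ { s (m″ , n″ , a″ , r″ , a″≤x , s≈) → ≤-respˡ-≈ (sym s≈)
                   (<⇒≤ (Root-reflects-< {m″} {n″} {a″} {m′} {n′} {a′} r″ r′ (≤-<-trans a″≤x x<a′))) }
      in <⇒≱ (Root-reflects-< {m′} {n′} {a′} {m} {n} {a} r′ r a′<a) (≤-trans q≤y y≤q′)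
    below : ∀ {m n a} → Root m n a → a ≤ x → PowerBelow y a
    below {m} {n} {a} r a≤x = mkℚᵘ (+ m) n , y-upper _ (m , n , a , r , a≤x , refl) , r
    least : ∀ b → IsUpperBound _≤_ (PowerBelow y) b → x ≤ b
    least b b-upper = ≮⇒≥ λ b<x →
      -- The power 2⁰ belongs to the set, which secures the hypothesis `1# ≤ b` of `Root-dense`.
      let 1≤b = b-upper 1# (below {0} {0} Root-1 1≤x)
          m , n , a , r , b<a , a<x = Root-dense 1≤b b<x
      in <⇒≱ b<a (b-upper a (below {m} {n} r (<⇒≤ a<x)))

  exp₂-surjective : ∀ {x} → 1# ≤ x → ∃ λ y → exp₂ y ≈ x
  exp₂-surjective {x} 1≤x =
    let y , y-sup = supremum (LogSet x) (_ , 0 , 0 , 1# , Root-1 , 1≤x , refl) (LogSet-bounded 1≤x)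
        x-sup = Sup-LogSet⇒Sup-PowerBelow 1≤x y-sup
    in y , Sup-unique (the-spec {Sup (PowerBelow y)} (x , x-sup)) x-sup

  -- Without a supremum `exp₂ y` would take the default value `0#`, and a value of at least 1 rules
  -- this out.
  exp₂-Sup : ∀ {x y} → 1# ≤ x → exp₂ y ≈ x → ∃ λ s → s ≈ x × Sup (PowerBelow y) s
  exp₂-Sup {x} {y} 1≤x exp₂y≈x with em {P = ∃ (Sup (PowerBelow y))}
  ... | yes (s , s-sup) = s , exp₂y≈x , s-sup
  ... | no _            = ⊥-elim (<⇒≱ 0<1 (≤-trans 1≤x (≤-reflexive (sym exp₂y≈x))))

  PowerBelow-<ℕ : ∀ {y a} j → y < fromℕ j → PowerBelow y a → a ≤ fromℕ 2 ^ j
  PowerBelow-<ℕ j y<j (mkℚᵘ (+ m) n , q≤y , r) =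
    Root-mono {m} {n} {_} {j} {0} r (Root-integer j)
      (≤-respʳ-≈ (sym (frac-0 j)) (≤-trans q≤y (<⇒≤ y<j)))
  PowerBelow-<ℕ j y<j (mkℚᵘ -[1+ m ] n , q≤y , r) =
    ≤-trans (negative-power-≤1 {m} {n} r) (1≤x^n j 1≤fromℕ2)

  PowerBelow-<-1 : ∀ {y a} → y < - 1# → PowerBelow y a → fromℕ 2 * a ≤ 1#
  PowerBelow-<-1 {y} y<-1 (mkℚᵘ (+ m) n , q≤y , r) =
    contradiction (≤-trans 0≤q q≤y) (<⇒≱ (<-≤-trans y<-1 (-neg 0≤1)))
    where
    0≤q : 0# ≤ frac m n
    0≤q = *-nonneg (fromℕ-nonneg m) (<⇒≤ (⁻¹-pos (fromℕ-pos n)))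
  PowerBelow-<-1 {y} y<-1 (mkℚᵘ -[1+ m ] n , q≤y , r) =
    negative-power-≤½ {m} {n} r (fromℕ-cancel-≤ (≤-from-difference (difference-nonneg (begin
      - M           ≈⟨ x/y*y≈x _ (pos⇒≉0 (fromℕ-pos n)) ⟨
      - M / N * N   ≤⟨ *-monoʳ-≤ (fromℕ-nonneg (suc n)) (≤-trans q≤y (<⇒≤ y<-1)) ⟩
      - 1# * N      ∎))
      (solve 2 (λ M N → (:- num 1) :* N :- (:- M) := M :- N) refl M N)))
    where
    open ≤-Reasoning
    M N : ℝ
    M = fromℕ (suc m)
    N = fromℕ (suc n)

  -- If log₂ x were below j - 1, then 2ʲ⁻¹ would bound all the powers whose supremum is `x`, against
  -- 2ʲ ≤ x. The slack of 1 leaves a factor of 2 that makes this nonstrict bound contradictory. For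
  -- j = 0 the bound is ½, against 1 ≤ x.
  log₂-lower : ∀ {x} j → 1# ≤ x → fromℕ 2 ^ j ≤ x → fromℕ j ≤ log₂ x + 1#
  log₂-lower {x} j 1≤x 2ʲ≤x =
    let s , s≈x , (_ , s-least) = exp₂-Sup 1≤x (the-spec (exp₂-surjective 1≤x))
        least = λ b (b-upper : IsUpperBound _≤_ (PowerBelow (log₂ x)) b) →
          ≤-respˡ-≈ s≈x (s-least b b-upper)
    in lower j 2ʲ≤x least
    where
    open ≤-Reasoning
    y : ℝ
    y = log₂ x
    ½ : ℝ
    ½ = 1# / fromℕ 2
    lower : ∀ j → fromℕ 2 ^ j ≤ x → (∀ b → IsUpperBound _≤_ (PowerBelow y) b → x ≤ b) →
            fromℕ j ≤ y + 1#
    lower zero _ least = ≮⇒≥ λ y+1<0 →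
      let y<-1 = ≰⇒> λ -1≤y → <⇒≱ y+1<0 (≤-from-difference (difference-nonneg -1≤y)
                   (solve 1 (λ y → y :- (:- num 1) := (y :+ num 1) :- num 0) refl y))
          x≤½ = least ½ λ a p → *-cancelˡ-≤ 0<2 (≤-trans (PowerBelow-<-1 y<-1 p)
                   (≤-reflexive (trans (sym (x/y*y≈x 1# (pos⇒≉0 0<2))) (*-comm _ _))))
      in <⇒≱ (fromℕ-<-suc 1) (begin
        fromℕ 2        ≈⟨ *-identityˡ _ ⟨
        1# * fromℕ 2   ≤⟨ *-monoʳ-≤ (<⇒≤ 0<2) (≤-trans 1≤x x≤½) ⟩
        ½ * fromℕ 2    ≈⟨ x/y*y≈x 1# (pos⇒≉0 0<2) ⟩
        1#             ≈⟨ +-identityʳ 1# ⟨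
        fromℕ 1        ∎)
    lower (suc j) 2ʲ⁺¹≤x least = ≮⇒≥ λ y+1<j+1 →
      let y<j = ≰⇒> λ j≤y → <⇒≱ y+1<j+1 (≤-trans (+-monoʳ-≤ 1# j≤y) (≤-reflexive (+-comm 1# y)))
          2ʲ⁺¹≤2ʲ = ≤-trans 2ʲ⁺¹≤x (least (fromℕ 2 ^ j) λ a p → PowerBelow-<ℕ j y<j p)
      in <⇒≱ (x<x+pos (fromℕ 2 ^ j) (^-pos j 0<2)) (begin
        fromℕ 2 ^ j + fromℕ 2 ^ j   ≈⟨ solve 1 (λ p → p :+ p := num 2 :* p) refl (fromℕ 2 ^ j) ⟩
        2# * fromℕ 2 ^ j            ≈⟨ *-congʳ fromℕ2≈2 ⟨
        fromℕ 2 ^ suc j             ≤⟨ 2ʲ⁺¹≤2ʲ ⟩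
        fromℕ 2 ^ j                 ∎)

  -- Squared distances

  dist² : ∀ {d} → Vector ℝ d → Vector ℝ d → ℝ
  dist² {d} x y = ∑[ i < d ] ((x i - y i) * (x i - y i))

  dist²-expand : ∀ {d} (x y : Vector ℝ d) → dist² x y ≈ (⟨ x , x ⟩ + ⟨ y , y ⟩) - 2# * ⟨ x , y ⟩
  dist²-expand {zero}  x y = solve 0 (num 0 := (num 0 :+ num 0) :- num 2 :* num 0) refl
  dist²-expand {suc d} x y = trans (+-congˡ (dist²-expand (x ∘ suc) (y ∘ suc)))
    (solve 5 (λ a b p q s → (a :- b) :* (a :- b) :+ ((p :+ q) :- num 2 :* s) :=
                ((a :* a :+ p) :+ (b :* b :+ q)) :- num 2 :* (a :* b :+ s))
      refl (x zero) (y zero) ⟨ x ∘ suc , x ∘ suc ⟩ ⟨ y ∘ suc , y ∘ suc ⟩ ⟨ x ∘ suc , y ∘ suc ⟩)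

  dist²-sphere : ∀ {d} (x y : SpherePoint d) → dist² (proj₁ x) (proj₁ y) ≈ 2# * (1# - ⟪ x , y ⟫)
  dist²-sphere (x , x-unit) (y , y-unit) = begin-equality
    dist² x y                                  ≈⟨ dist²-expand x y ⟩
    (⟨ x , x ⟩ + ⟨ y , y ⟩) - 2# * ⟨ x , y ⟩   ≈⟨ +-congʳ (+-cong x-unit y-unit) ⟩
    (1# + 1#) - 2# * ⟨ x , y ⟩                 ≈⟨ solve 1 (λ s → num 2 :- num 2 :* s :=
                                                    num 2 :* (num 1 :- s)) refl ⟨ x , y ⟩ ⟩
    2# * (1# - ⟨ x , y ⟩)                      ∎
    where open ≤-Reasoning

  -- Weighted AM–GM, (u + w)² ≤ (1 + c) u² + (1 + c⁻¹) w², replaces the triangle inequality.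
  square-perturb : ∀ {c e} → 0# ≤ c → 0# ≤ e → c * e ≈ 1# → ∀ x y x′ y′ →
    (x′ - y′) * (x′ - y′) ≤ (1# + c) * ((x - y) * (x - y))
      + (1# + e) * (2# * ((x - x′) * (x - x′) + (y - y′) * (y - y′)))
  square-perturb {c} {e} 0≤c 0≤e ce≈1 x y x′ y′ = begin
    (x′ - y′) * (x′ - y′)
        ≈⟨ solve 4 (λ x y x′ y′ → (x′ :- y′) :* (x′ :- y′) :=
           ((x :- y) :+ ((y :- y′) :- (x :- x′))) :* ((x :- y) :+ ((y :- y′) :- (x :- x′))))
           refl x y x′ y′ ⟩
    (u + w) * (u + w)   ≤⟨ am-gm ⟩
    (1# + c) * (u * u) + (1# + e) * (w * w)
        ≤⟨ +-monoʳ-≤ _ (*-monoˡ-≤ (+-nonneg 0≤1 0≤e) w²≤) ⟩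
    (1# + c) * (u * u) + (1# + e) * (2# * (a * a + b * b))  ∎
    where
    open ≤-Reasoning
    a b u w : ℝ
    a = x - x′
    b = y - y′
    u = x - y
    w = b - a
    w²≤ : w * w ≤ 2# * (a * a + b * b)
    w²≤ = ≤-from-difference (square-nonneg (a + b))
      (solve 2 (λ a b → (a :+ b) :* (a :+ b) :=
         num 2 :* (a :* a :+ b :* b) :- (b :- a) :* (b :- a)) refl a b)
    am-gm : (u + w) * (u + w) ≤ (1# + c) * (u * u) + (1# + e) * (w * w)
    -- The difference of the two sides is c u² - 2 u w + e w², which equals e (c u - w)² by c e = 1.
    -- The solver cannot use this relation, so it is substituted between two ring identities.
    am-gm = ≤-from-difference (*-nonneg 0≤e (square-nonneg (c * u - w))) (begin-equality
      e * ((c * u - w) * (c * u - w))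
          ≈⟨ solve 4 (λ c e u w → e :* ((c :* u :- w) :* (c :* u :- w)) :=
             (c :* e) :* (c :* (u :* u) :- num 2 :* (u :* w)) :+ e :* (w :* w)) refl c e u w ⟩
      (c * e) * (c * (u * u) - 2# * (u * w)) + e * (w * w)            ≈⟨ +-congʳ (*-congʳ ce≈1) ⟩
      1# * (c * (u * u) - 2# * (u * w)) + e * (w * w)
          ≈⟨ solve 4 (λ c e u w →
             num 1 :* (c :* (u :* u) :- num 2 :* (u :* w)) :+ e :* (w :* w) :=
             ((num 1 :+ c) :* (u :* u) :+ (num 1 :+ e) :* (w :* w)) :- (u :+ w) :* (u :+ w))
             refl c e u w ⟩
      ((1# + c) * (u * u) + (1# + e) * (w * w)) - (u + w) * (u + w)   ∎)

  -- Weighted AM-GM is linear in the squares and therefore sums over the coordinates; no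
  -- Cauchy-Schwarz inequality is involved.
  dist²-perturb : ∀ {c e} → 0# ≤ c → 0# ≤ e → c * e ≈ 1# → ∀ {d} (x y x′ y′ : Vector ℝ d) →
    dist² x′ y′ ≤ (1# + c) * dist² x y + (1# + e) * (2# * (dist² x x′ + dist² y y′))
  dist²-perturb {c} {e} 0≤c 0≤e ce≈1 {zero} x y x′ y′ = ≤-reflexive
    (solve 2 (λ c e → num 0 :=
       (num 1 :+ c) :* num 0 :+ (num 1 :+ e) :* (num 2 :* (num 0 :+ num 0))) refl c e)
  dist²-perturb {c} {e} 0≤c 0≤e ce≈1 {suc d} x y x′ y′ = ≤-trans
    (+-mono-≤ (square-perturb 0≤c 0≤e ce≈1 (x zero) (y zero) (x′ zero) (y′ zero))
              (dist²-perturb 0≤c 0≤e ce≈1 (x ∘ suc) (y ∘ suc) (x′ ∘ suc) (y′ ∘ suc)))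
    (≤-reflexive (solve 8 (λ c e p q r p′ q′ r′ →
        ((num 1 :+ c) :* p :+ (num 1 :+ e) :* (num 2 :* (q :+ r)))
        :+ ((num 1 :+ c) :* p′ :+ (num 1 :+ e) :* (num 2 :* (q′ :+ r′)))
        := (num 1 :+ c) :* (p :+ p′) :+ (num 1 :+ e) :* (num 2 :* ((q :+ q′) :+ (r :+ r′))))
      refl c e ((x zero - y zero) * (x zero - y zero)) ((x zero - x′ zero) * (x zero - x′ zero))
      ((y zero - y′ zero) * (y zero - y′ zero)) (dist² (x ∘ suc) (y ∘ suc))
      (dist² (x ∘ suc) (x′ ∘ suc)) (dist² (y ∘ suc) (y′ ∘ suc))))

  0<2# : 0# < 2#
  0<2# = <-≤-trans 0<1 (<⇒≤ (x<x+pos 1# 0<1))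

  -- The two pairs play symmetric roles: `close` passes from the given points to the decoded ones,
  -- `far` in the opposite direction.
  inner-product-perturb : ∀ {c e δ} → 0# ≤ c → 0# ≤ e → c * e ≈ 1# → ∀ {d} (x y x′ y′ : SpherePoint d) →
    dist² (proj₁ x) (proj₁ x′) ≤ δ → dist² (proj₁ y) (proj₁ y′) ≤ δ →
    1# - ⟪ x′ , y′ ⟫ ≤ (1# + c) * (1# - ⟪ x , y ⟫) + (1# + e) * (2# * δ)
  inner-product-perturb {c} {e} {δ} 0≤c 0≤e ce≈1 x y x′ y′ xx′≤δ yy′≤δ = *-cancelˡ-≤ 0<2# (begin
    2# * (1# - ⟪ x′ , y′ ⟫)   ≈⟨ dist²-sphere x′ y′ ⟨
    dist² (proj₁ x′) (proj₁ y′)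
        ≤⟨ dist²-perturb 0≤c 0≤e ce≈1 (proj₁ x) (proj₁ y) (proj₁ x′) (proj₁ y′) ⟩
    (1# + c) * dist² (proj₁ x) (proj₁ y)
      + (1# + e) * (2# * (dist² (proj₁ x) (proj₁ x′) + dist² (proj₁ y) (proj₁ y′)))
        ≤⟨ +-mono-≤ (≤-reflexive (*-congˡ (dist²-sphere x y)))
           (*-monoˡ-≤ (+-nonneg 0≤1 0≤e) (*-monoˡ-≤ (<⇒≤ 0<2#) (+-mono-≤ xx′≤δ yy′≤δ))) ⟩
    (1# + c) * (2# * (1# - ⟪ x , y ⟫)) + (1# + e) * (2# * (δ + δ))
        ≈⟨ solve 4 (λ c e s δ → (num 1 :+ c) :* (num 2 :* s) :+ (num 1 :+ e) :* (num 2 :* (δ :+ δ)) :=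
           num 2 :* ((num 1 :+ c) :* s :+ (num 1 :+ e) :* (num 2 :* δ))) refl c e (1# - ⟪ x , y ⟫) δ ⟩
    2# * ((1# + c) * (1# - ⟪ x , y ⟫) + (1# + e) * (2# * δ))  ∎)
    where open ≤-Reasoning

  -- The error budget

  infix 9 #_
  -- The value of the solver's `num n`, so that ring identities with large constants apply as they
  -- stand.
  #_ : ℕ → ℝ
  # n = ⟦ + n ⟧

  #-pos : ∀ n → 0# < # (suc n)
  #-pos n = <-≤-trans (fromℕ-pos n) (≤-reflexive (×ᵤ≈× (suc n) 1#))

  -- The accumulated error of perturbing a pair of points and back stays below the gap B - A.
  gap : ∀ {A B c e δ g} → 0# ≤ A → A ≤ B → 0# ≤ c → c ≤ 1# → 1# ≤ e → 0# ≤ δ → 0# < g →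
        B - A ≈ g → c * (# 6 * B) ≈ g → e * g ≈ # 6 * B → # 256 * (B * δ) < g * g →
        (1# + c) * ((1# + c) * A + (1# + e) * (2# * δ)) + (1# + e) * (2# * δ) < B
  gap {A} {B} {c} {e} {δ} {g} 0≤A A≤B 0≤c c≤1 1≤e 0≤δ 0<g B-A≈g c6B≈g eg≈6B 256Bδ<g² =
    ≰⇒> λ B≤E → <⇒≱ 24eδg<g² (*-monoˡ-≤ (<⇒≤ 0<g) (g≤24eδ (≤-trans B≤E E≤)))
    where
    open ≤-Reasoning
    -- By c ≤ 1 ≤ e, (1 + c)² ≤ 1 + 3c and (2 + c)(1 + e) ≤ 6e.
    E≤ : (1# + c) * ((1# + c) * A + (1# + e) * (2# * δ)) + (1# + e) * (2# * δ)
         ≤ (A + # 3 * (c * B)) + # 12 * (e * δ)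
    E≤ = ≤-from-difference
      (+-nonneg (+-nonneg
        (*-nonneg (<⇒≤ (#-pos 2)) (*-nonneg 0≤c (difference-nonneg A≤B)))
        (*-nonneg 0≤c (*-nonneg (difference-nonneg c≤1) 0≤A)))
        (*-nonneg (<⇒≤ 0<2#) (*-nonneg 0≤δ (+-nonneg
          (*-nonneg (difference-nonneg c≤1) (+-nonneg 0≤1 (≤-trans 0≤1 1≤e)))
          (*-nonneg (<⇒≤ (#-pos 2)) (difference-nonneg 1≤e))))))
      (solve 5 (λ A B c e δ →
          (num 3 :* (c :* (B :- A)) :+ c :* ((num 1 :- c) :* A))
            :+ num 2 :* (δ :* ((num 1 :- c) :* (num 1 :+ e) :+ num 3 :* (e :- num 1)))
          := ((A :+ num 3 :* (c :* B)) :+ num 12 :* (e :* δ))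
            :- ((num 1 :+ c) :* ((num 1 :+ c) :* A :+ (num 1 :+ e) :* (num 2 :* δ))
              :+ (num 1 :+ e) :* (num 2 :* δ)))
        refl A B c e δ)
    g≤24eδ : B ≤ (A + # 3 * (c * B)) + # 12 * (e * δ) → g ≤ # 24 * (e * δ)
    g≤24eδ B≤ = begin
      g                ≈⟨ solve 1 (λ g → g := (num 2 :* g) :- g) refl g ⟩
      2# * g - g       ≈⟨ +-cong (*-congˡ B-A≈g) (-‿cong c6B≈g) ⟨
      2# * (B - A) - c * (# 6 * B)
          ≤⟨ ≤-from-difference (*-nonneg (<⇒≤ 0<2#) (difference-nonneg B≤))
             (solve 5 (λ A B c e δ →
                num 2 :* (((A :+ num 3 :* (c :* B)) :+ num 12 :* (e :* δ)) :- B) :=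
                num 24 :* (e :* δ) :- (num 2 :* (B :- A) :- c :* (num 6 :* B)))
                refl A B c e δ) ⟩
      # 24 * (e * δ)   ∎
    24eδg<g² : g * (# 24 * (e * δ)) < g * g
    24eδg<g² = begin-strict
      g * (# 24 * (e * δ))
          ≈⟨ solve 3 (λ g e δ → g :* (num 24 :* (e :* δ)) := num 24 :* ((e :* g) :* δ)) refl g e δ ⟩
      # 24 * ((e * g) * δ)   ≈⟨ *-congˡ (*-congʳ eg≈6B) ⟩
      # 24 * ((# 6 * B) * δ)
          -- The argument needs 24 · 6 = 144; it is rounded up to 256 = 16², the square of a power
          -- of 2.
          ≤⟨ ≤-from-difference (*-nonneg (<⇒≤ (#-pos 111)) (*-nonneg (≤-trans 0≤A A≤B) 0≤δ))
             (solve 2 (λ B δ → num 112 :* (B :* δ) :=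
                num 256 :* (B :* δ) :- num 24 :* ((num 6 :* B) :* δ)) refl B δ) ⟩
      # 256 * (B * δ)        <⟨ 256Bδ<g² ⟩
      g * g                  ∎

  -- Quantisation

  -- A relation, because `floor` chooses its integer by excluded middle: that `≈`-equal reals get
  -- the same one follows from uniqueness.
  Floor : ℝ → ℕ → Set
  Floor v n = fromℕ n ≤ v × v < fromℕ (suc n)

  Floor-≤ : ∀ {v v′ m n} → v ≈ v′ → Floor v m → Floor v′ n → m ℕ.≤ n
  Floor-≤ v≈v′ (m≤v , _) (_ , v′<1+n) =
    ℕ.≤-pred (fromℕ-cancel-< (≤-<-trans (≤-trans m≤v (≤-reflexive v≈v′)) v′<1+n))

  Floor-unique : ∀ {v v′ m n} → v ≈ v′ → Floor v m → Floor v′ n → m ≡ n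
  Floor-unique v≈v′ fm fn = ℕ.≤-antisym (Floor-≤ v≈v′ fm fn) (Floor-≤ (sym v≈v′) fn fm)

  Floor-near : ∀ {v v′ n} → Floor v n → Floor v′ n → (v - v′) * (v - v′) ≤ 1#
  Floor-near {v} {v′} {n} (n≤v , v<1+n) (n≤v′ , v′<1+n) = ≤-from-difference
    (*-nonneg (gap≥0 n≤v (<⇒≤ v′<1+n)) (gap≥0 n≤v′ (<⇒≤ v<1+n)))
    (solve 2 (λ v v′ → (num 1 :+ v :- v′) :* (num 1 :+ v′ :- v) :=
        num 1 :- (v :- v′) :* (v :- v′)) refl v v′)
    where
    gap≥0 : ∀ {a b} → fromℕ n ≤ a → b ≤ fromℕ (suc n) → 0# ≤ 1# + a - b
    gap≥0 n≤a b≤1+n = difference-nonneg (≤-trans b≤1+n (+-monoʳ-≤ 1# n≤a))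

  Quantum : ℝ → ℝ → Bool × ℕ → Set
  Quantum s x (true  , n) = 0# ≤ x × Floor (x * s) n
  Quantum s x (false , n) = x < 0# × Floor (- x * s) n

  neg-nonneg : ∀ {x} → x < 0# → 0# ≤ - x
  neg-nonneg {x} x<0 = ≤-respʳ-≈ (+-identityˡ (- x)) (difference-nonneg (<⇒≤ x<0))

  quantize : ∀ {s} → 0# ≤ s → ∀ x → ∃ (Quantum s x)
  quantize {s} 0≤s x with em {P = 0# ≤ x}
  ... | yes 0≤x = let n , fl = floor (*-nonneg 0≤x 0≤s) in (true , n) , 0≤x , fl
  ... | no  0≰x = let n , fl = floor (*-nonneg (neg-nonneg (≰⇒> 0≰x)) 0≤s) in (false , n) , ≰⇒> 0≰x , fl

  Quantum-unique : ∀ {s x y} p q → x ≈ y → Quantum s x p → Quantum s y q → p ≡ q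
  Quantum-unique (true  , m) (true  , n) x≈y (_ , fm) (_ , fn) =
    ≡.cong (true ,_) (Floor-unique (*-congʳ x≈y) fm fn)
  Quantum-unique (false , m) (false , n) x≈y (_ , fm) (_ , fn) =
    ≡.cong (false ,_) (Floor-unique (*-congʳ (-‿cong x≈y)) fm fn)
  Quantum-unique (true  , m) (false , n) x≈y (0≤x , _) (y<0 , _) =
    contradiction (≤-respʳ-≈ x≈y 0≤x) (<⇒≱ y<0)
  Quantum-unique (false , m) (true  , n) x≈y (x<0 , _) (0≤y , _) =
    contradiction (≤-respʳ-≈ (sym x≈y) 0≤y) (<⇒≱ x<0)

  Quantum-near : ∀ {s x y} p → Quantum s x p → Quantum s y p → (x - y) * (x - y) * (s * s) ≤ 1#
  Quantum-near {s} {x} {y} (true , n) (_ , fx) (_ , fy) = ≤-respˡ-≈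
    (solve 3 (λ x y s → (x :* s :- y :* s) :* (x :* s :- y :* s) :=
       (x :- y) :* (x :- y) :* (s :* s)) refl x y s)
    (Floor-near {n = n} fx fy)
  Quantum-near {s} {x} {y} (false , n) (_ , fx) (_ , fy) = ≤-respˡ-≈
    (solve 3 (λ x y s → ((:- x) :* s :- (:- y) :* s) :* ((:- x) :* s :- (:- y) :* s) :=
       (x :- y) :* (x :- y) :* (s :* s)) refl x y s)
    (Floor-near {n = n} fx fy)

  Floor-square : ∀ {v n} → Floor v n → fromℕ n * fromℕ n ≤ v * v
  Floor-square {v} {n} (n≤v , _) = *-mono-≤ (fromℕ-nonneg n) (≤-trans (fromℕ-nonneg n) n≤v) n≤v n≤v

  -- Here rounding towards 0 matters: it never increases the absolute value, as rounding down would
  -- for negative numbers.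
  Quantum-square : ∀ {s x} p → Quantum s x p → fromℕ (proj₂ p) * fromℕ (proj₂ p) ≤ x * x * (s * s)
  Quantum-square {s} {x} (true  , n) (_ , fl) = ≤-trans (Floor-square {n = n} fl) (≤-reflexive
    (solve 2 (λ x s → (x :* s) :* (x :* s) := x :* x :* (s :* s)) refl x s))
  Quantum-square {s} {x} (false , n) (_ , fl) = ≤-trans (Floor-square {n = n} fl) (≤-reflexive
    (solve 2 (λ x s → ((:- x) :* s) :* ((:- x) :* s) := x :* x :* (s :* s)) refl x s))

  n≤n*n : ∀ n → n ℕ.≤ n ℕ.* n
  n≤n*n zero    = z≤n
  n≤n*n (suc n) = ℕ.m≤m*n (suc n) (suc n)

  quotient-bound : ∀ {D x s} k n → s * s ≈ D * (fromℕ 2 ^ k * fromℕ 2 ^ k) →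
    fromℕ n * fromℕ n ≤ x * x * (s * s) → fromℕ ⌊ n /2^ k ⌋ ≤ D * (x * x)
  quotient-bound {D} {x} {s} k n s²≈ n²≤ = begin
    Q                 ≤⟨ fromℕ-mono-≤ (n≤n*n q) ⟩
    fromℕ (q ℕ.* q)   ≈⟨ fromℕ-homo-* q q ⟩
    Q * Q
        ≤⟨ *-cancelˡ-≤ (*-pos 0<P 0<P) (begin
           P * P * (Q * Q)
               ≈⟨ solve 2 (λ P Q → P :* P :* (Q :* Q) := (P :* Q) :* (P :* Q)) refl P Q ⟩
           (P * Q) * (P * Q)
               ≤⟨ *-mono-≤ (*-nonneg (<⇒≤ 0<P) (fromℕ-nonneg q)) (fromℕ-nonneg n) PQ≤n PQ≤n ⟩
           fromℕ n * fromℕ n       ≤⟨ n²≤ ⟩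
           x * x * (s * s)         ≈⟨ *-congˡ s²≈ ⟩
           x * x * (D * (P * P))
               ≈⟨ solve 3 (λ D x P → x :* x :* (D :* (P :* P)) := P :* P :* (D :* (x :* x)))
                  refl D x P ⟩
           P * P * (D * (x * x))   ∎) ⟩
    D * (x * x)       ∎
    where
    open ≤-Reasoning
    q : ℕ
    q = ⌊ n /2^ k ⌋
    P Q : ℝ
    P = fromℕ 2 ^ k
    Q = fromℕ q
    0<P : 0# < P
    0<P = ^-pos k 0<2
    PQ≤n : P * Q ≤ fromℕ n
    PQ≤n = begin
      P * Q                   ≈⟨ *-congʳ (fromℕ-homo-^ 2 k) ⟨
      fromℕ (2 ℕ.^ k) * Q     ≈⟨ fromℕ-homo-* (2 ℕ.^ k) q ⟨
      fromℕ (2 ℕ.^ k ℕ.* q)   ≤⟨ fromℕ-mono-≤ (2^k*⌊n/2^k⌋≤n k n) ⟩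
      fromℕ n                 ∎

  -- The `2 + k` bits are the sign, the low bits and the end mark of the unary part. The unary
  -- digits are controlled only in total, through `⟨ x , x ⟩`.
  length-codes : ∀ {n} k (p : Fin n → Bool × ℕ) D (x : Vector ℝ n) →
    (∀ i → fromℕ ⌊ proj₂ (p i) /2^ k ⌋ ≤ D * (x i * x i)) →
    fromℕ (length (codes k p)) ≤ fromℕ (n ℕ.* (2 ℕ.+ k)) + D * ⟨ x , x ⟩
  length-codes {zero}  k p D x h = ≤-reflexive (solve 1 (λ D → num 0 := num 0 :+ D :* num 0) refl D)
  length-codes {suc n} k p D x h = begin
    fromℕ (suc (length (golomb k z ++ rest)))
        ≡⟨ ≡.cong (fromℕ ∘ suc) (≡.trans (length-++ (golomb k z))
             (≡.cong (ℕ._+ length rest) (length-golomb k z))) ⟩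
    fromℕ ((2 ℕ.+ k ℕ.+ q) ℕ.+ length rest)
        ≈⟨ trans (fromℕ-homo-+ (2 ℕ.+ k ℕ.+ q) (length rest)) (+-congʳ (fromℕ-homo-+ (2 ℕ.+ k) q)) ⟩
    (K + fromℕ q) + fromℕ (length rest)
        ≤⟨ +-mono-≤ (+-monoʳ-≤ K (h zero)) (length-codes k (p ∘ suc) D (x ∘ suc) (h ∘ suc)) ⟩
    (K + D * a) + (N + D * b)
        ≈⟨ solve 5 (λ K D a N b → (K :+ D :* a) :+ (N :+ D :* b) := (K :+ N) :+ D :* (a :+ b))
             refl K D a N b ⟩
    (K + N) + D * (a + b)
        ≈⟨ +-congʳ (fromℕ-homo-+ (2 ℕ.+ k) (n ℕ.* (2 ℕ.+ k))) ⟨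
    fromℕ (suc n ℕ.* (2 ℕ.+ k)) + D * (a + b)  ∎
    where
    open ≤-Reasoning
    z q : ℕ
    z = proj₂ (p zero)
    q = ⌊ z /2^ k ⌋
    rest : List Bool
    rest = codes k (p ∘ suc)
    K N a b : ℝ
    K = fromℕ (2 ℕ.+ k)
    N = fromℕ (n ℕ.* (2 ℕ.+ k))
    a = x zero * x zero
    b = ⟨ x ∘ suc , x ∘ suc ⟩

  dist²-bound : ∀ {n} (x y : Vector ℝ n) c →
    (∀ i → (x i - y i) * (x i - y i) * c ≤ 1#) → dist² x y * c ≤ fromℕ n
  dist²-bound {zero}  x y c h = ≤-reflexive (zeroˡ c)
  dist²-bound {suc n} x y c h = ≤-respˡ-≈ (sym (distribʳ c _ _))
    (+-mono-≤ (h zero) (dist²-bound (x ∘ suc) (y ∘ suc) c (h ∘ suc)))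

  -- Provides the value of `decode` at bit strings that are not codes; a point of the sphere exists
  -- because the dimension is positive.
  basisVector : ∀ d → Vector ℝ (suc d)
  basisVector d zero    = 1#
  basisVector d (suc _) = 0#

  ⟨0,0⟩ : ∀ d → ⟨ (λ (_ : Fin d) → 0#) , (λ _ → 0#) ⟩ ≈ 0#
  ⟨0,0⟩ zero    = refl
  ⟨0,0⟩ (suc d) = trans (+-cong (zeroˡ 0#) (⟨0,0⟩ d)) (+-identityˡ 0#)

  basisPoint : ∀ d → SpherePoint (suc d)
  basisPoint d = basisVector d , trans (+-cong (*-identityˡ 1#) (⟨0,0⟩ d)) (+-identityʳ 1#)

  -- Coding the sphere

  module Quantiser (d : ℕ) (k : ℕ) (σ : ℝ) (0≤σ : 0# ≤ σ) (σ²≈d : σ * σ ≈ fromℕ (suc d)) where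

    ℓ : ℕ
    ℓ = suc d ℕ.* (2 ℕ.+ k) ℕ.+ suc d

    D P s : ℝ
    D = fromℕ (suc d)
    P = fromℕ 2 ^ k
    s = σ * P

    0≤s : 0# ≤ s
    0≤s = *-nonneg 0≤σ (<⇒≤ (^-pos k 0<2))

    s²≈ : s * s ≈ D * (P * P)
    s²≈ = trans (solve 2 (λ σ P → (σ :* P) :* (σ :* P) := (σ :* σ) :* (P :* P)) refl σ P) (*-congʳ σ²≈d)

    quanta : SpherePoint (suc d) → Fin (suc d) → Bool × ℕ
    quanta x i = proj₁ (quantize 0≤s (proj₁ x i))

    quanta-spec : ∀ x i → Quantum s (proj₁ x i) (quanta x i)
    quanta-spec x i = proj₂ (quantize 0≤s (proj₁ x i))

    encode : SpherePoint (suc d) → Vec Bool ℓ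
    encode x = pad ℓ (codes k (quanta x))

    length-quanta : ∀ x → length (codes k (quanta x)) ℕ.≤ ℓ
    length-quanta x = fromℕ-cancel-≤ (begin
      fromℕ (length (codes k (quanta x)))
          ≤⟨ length-codes k (quanta x) D (proj₁ x) (λ i →
             quotient-bound {x = proj₁ x i} k (proj₂ (quanta x i)) s²≈
               (Quantum-square (quanta x i) (quanta-spec x i))) ⟩
      fromℕ (suc d ℕ.* (2 ℕ.+ k)) + D * ⟨ proj₁ x , proj₁ x ⟩
          ≈⟨ +-congˡ (trans (*-congˡ (proj₂ x)) (*-identityʳ D)) ⟩
      fromℕ (suc d ℕ.* (2 ℕ.+ k)) + D
          ≈⟨ fromℕ-homo-+ (suc d ℕ.* (2 ℕ.+ k)) (suc d) ⟨
      fromℕ ℓ  ∎)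
      where open ≤-Reasoning

    encode-cong : ∀ {x y} → (∀ i → proj₁ x i ≈ proj₁ y i) → encode x ≡ encode y
    encode-cong {x} {y} x≈y = ≡.cong (pad ℓ) (codes-cong k λ i →
      Quantum-unique (quanta x i) (quanta y i) (x≈y i) (quanta-spec x i) (quanta-spec y i))

    -- Each of the d coordinates contributes at most 1 / s² = 1 / (d 4ᵏ); the factor √d in the scale
    -- cancels their number.
    encode-fibre : ∀ x y → encode x ≡ encode y → dist² (proj₁ x) (proj₁ y) ≤ (P * P) ⁻¹
    encode-fibre x y eq = *-cancelˡ-≤ (*-pos (fromℕ-pos d) 0<P²) (begin
      D * (P * P) * dist² (proj₁ x) (proj₁ y)   ≈⟨ *-congʳ s²≈ ⟨
      (s * s) * dist² (proj₁ x) (proj₁ y)       ≈⟨ *-comm _ _ ⟩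
      dist² (proj₁ x) (proj₁ y) * (s * s)
          ≤⟨ dist²-bound (proj₁ x) (proj₁ y) (s * s) (λ i →
             Quantum-near (quanta x i) (quanta-spec x i)
               (≡.subst (Quantum s (proj₁ y i)) (≡.sym (quanta≡ i)) (quanta-spec y i))) ⟩
      D                                         ≈⟨ *-identityʳ D ⟨
      D * 1#                                    ≈⟨ *-congˡ (⁻¹-inverseʳ (pos⇒≉0 0<P²)) ⟨
      D * (P * P * (P * P) ⁻¹)                  ≈⟨ *-assoc _ _ _ ⟨
      D * (P * P) * (P * P) ⁻¹                  ∎)
      where
      open ≤-Reasoning
      0<P² : 0# < P * P
      0<P² = *-pos (^-pos k 0<2) (^-pos k 0<2)
      quanta≡ : ∀ i → quanta x i ≡ quanta y i
      quanta≡ = pad-codes-injective ℓ k (quanta x) (quanta y) (length-quanta x) (length-quanta y) eq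

    decode : Vec Bool ℓ → SpherePoint (suc d)
    decode v with em {P = ∃ λ x → encode x ≡ v}
    ... | yes (x , _) = x
    ... | no  _       = basisPoint d

    encode-decode : ∀ x → encode (decode (encode x)) ≡ encode x
    encode-decode x with em {P = ∃ λ y → encode y ≡ encode x}
    ... | yes (_ , eq) = eq
    ... | no  ∄        = contradiction (x , ≡.refl) ∄

    decode-near : ∀ x → dist² (proj₁ x) (proj₁ (decode (encode x))) ≤ (P * P) ⁻¹
    decode-near x = encode-fibre x (decode (encode x)) (≡.sym (encode-decode x))

    decode-near′ : ∀ x → dist² (proj₁ (decode (encode x))) (proj₁ x) ≤ (P * P) ⁻¹
    decode-near′ x = encode-fibre (decode (encode x)) x (encode-decode x)

    -- `T` bounds 1 - ⟨·,·⟩ of the decoded pair when the given pair is close. If a far pair also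
    -- decoded to at most `T`, perturbing back would give 1 - ⟨x,y⟩ < 1 - β.
    solution : ∀ {α β} → α ≤ 1# → β ≤ 1# → β < α →
               # 256 * ((1# - β) * (P * P) ⁻¹) < (α - β) * (α - β) →
               InnerProductSolution α β (suc d) ℓ
    solution {α} {β} α≤1 β≤1 β<α precise = record
      { encode      = encode
      ; encode-cong = λ {x} {y} → encode-cong {x} {y}
      ; decode      = decode
      ; t           = 1# - T
      ; close       = λ x y α≤xy → ≤-from-difference (difference-nonneg (begin
          1# - ⟪ decode (encode x) , decode (encode y) ⟫
              ≤⟨ inner-product-perturb 0≤c 0≤e ce≈1 x y
                 (decode (encode x)) (decode (encode y)) (decode-near x) (decode-near y) ⟩
          (1# + c) * (1# - ⟪ x , y ⟫) + (1# + e) * (2# * δ)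
              ≤⟨ +-mono-≤ (*-monoˡ-≤ 0≤1+c (1-anti α≤xy)) ≤-refl ⟩
          T  ∎))
          (solve 2 (λ T z → T :- (num 1 :- z) := z :- (num 1 :- T)) refl T _)
      ; far         = λ x y xy≤β → ≰⇒> λ t≤ → <⇒≱ error<B (begin
          B   ≤⟨ 1-anti xy≤β ⟩
          1# - ⟪ x , y ⟫
              ≤⟨ inner-product-perturb 0≤c 0≤e ce≈1 (decode (encode x)) (decode (encode y))
                 x y (decode-near′ x) (decode-near′ y) ⟩
          (1# + c) * (1# - ⟪ decode (encode x) , decode (encode y) ⟫) + (1# + e) * (2# * δ)
              ≤⟨ +-mono-≤ (*-monoˡ-≤ 0≤1+c (≤-respʳ-≈ 1-[1-T]≈T (1-anti t≤))) ≤-refl ⟩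
          (1# + c) * T + (1# + e) * (2# * δ)  ∎)
      }
      where
      open ≤-Reasoning
      1-anti : ∀ {u v} → u ≤ v → 1# - v ≤ 1# - u
      1-anti {u} {v} u≤v = ≤-from-difference (difference-nonneg u≤v)
        (solve 2 (λ u v → v :- u := (num 1 :- u) :- (num 1 :- v)) refl u v)
      A B g δ c e T : ℝ
      A = 1# - α
      B = 1# - β
      g = α - β
      δ = (P * P) ⁻¹
      -- This makes the relative error 3 c B equal to g / 2, leaving the other half of the gap to
      -- the absolute error.
      c = g / (# 6 * B)
      e = (# 6 * B) / g
      T = (1# + c) * A + (1# + e) * (2# * δ)
      1-[1-T]≈T : 1# - (1# - T) ≈ T
      1-[1-T]≈T = solve 1 (λ T → num 1 :- (num 1 :- T) := T) refl T
      0<g : 0# < g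
      0<g = difference-pos β<α
      0<B : 0# < B
      0<B = difference-pos (<-≤-trans β<α α≤1)
      0<6B : 0# < # 6 * B
      0<6B = *-pos (#-pos 5) 0<B
      g≤6B : g ≤ # 6 * B
      g≤6B = ≤-from-difference (+-nonneg (difference-nonneg α≤1) (*-nonneg (<⇒≤ (#-pos 4)) (<⇒≤ 0<B)))
        (solve 2 (λ α β → (num 1 :- α) :+ num 5 :* (num 1 :- β) :=
            num 6 :* (num 1 :- β) :- (α :- β)) refl α β)
      0≤c : 0# ≤ c
      0≤c = <⇒≤ (/-pos 0<g 0<6B)
      0≤e : 0# ≤ e
      0≤e = <⇒≤ (/-pos 0<6B 0<g)
      0≤1+c : 0# ≤ 1# + c
      0≤1+c = +-nonneg 0≤1 0≤c
      c≤1 : c ≤ 1#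
      c≤1 = ≤-*⇒/-≤ 0<6B (≤-respʳ-≈ (sym (*-identityˡ _)) g≤6B)
      eg≈6B : e * g ≈ # 6 * B
      eg≈6B = x/y*y≈x (# 6 * B) (pos⇒≉0 0<g)
      c6B≈g : c * (# 6 * B) ≈ g
      c6B≈g = x/y*y≈x g (pos⇒≉0 0<6B)
      ce≈1 : c * e ≈ 1#
      ce≈1 = begin-equality
        c * ((# 6 * B) * g ⁻¹)   ≈⟨ *-assoc _ _ _ ⟨
        c * (# 6 * B) * g ⁻¹     ≈⟨ *-congʳ c6B≈g ⟩
        g * g ⁻¹                 ≈⟨ ⁻¹-inverseʳ (pos⇒≉0 0<g) ⟩
        1#                       ∎
      1≤e : 1# ≤ e
      1≤e = begin
        1#       ≈⟨ ce≈1 ⟨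
        c * e    ≤⟨ *-monoʳ-≤ 0≤e c≤1 ⟩
        1# * e   ≈⟨ *-identityˡ e ⟩
        e        ∎
      error<B : (1# + c) * T + (1# + e) * (2# * δ) < B
      error<B = gap (difference-nonneg α≤1) (1-anti (<⇒≤ β<α)) 0≤c c≤1 1≤e
        (<⇒≤ (⁻¹-pos (*-pos (^-pos k 0<2) (^-pos k 0<2)))) 0<g
        (solve 2 (λ α β → (num 1 :- β) :- (num 1 :- α) := α :- β) refl α β)
        c6B≈g eg≈6B precise

  -- For X = √B / g and k = 5 + ⌊log₂ X⌋ we have 2ᵏ > 16 X.
  precise-enough : ∀ {B g r} j → 0# < B → 0# < g → 0# ≤ r → r * r ≈ B → r / g < fromℕ 2 ^ suc j →
    let P = fromℕ 2 ^ (5 ℕ.+ j) in # 256 * (B * (P * P) ⁻¹) < g * g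
  precise-enough {B} {g} {r} j 0<B 0<g 0≤r r²≈B r/g<Q = begin-strict
    # 256 * (B * δ)
        ≈⟨ solve 2 (λ B δ → num 256 :* (B :* δ) := (num 256 :* δ) :* B) refl B δ ⟩
    # 256 * δ * B                           <⟨ *-monoˡ-< (*-pos (#-pos 255) 0<δ) B<Q²g² ⟩
    # 256 * δ * ((Q * g) * (Q * g))
        ≈⟨ solve 3 (λ δ Q g → num 256 :* δ :* ((Q :* g) :* (Q :* g)) :=
           (((num 16 :* Q) :* (num 16 :* Q)) :* δ) :* (g :* g)) refl δ Q g ⟩
    (# 16 * Q) * (# 16 * Q) * δ * (g * g)   ≈⟨ *-congʳ (*-congʳ (*-cong P≈16Q P≈16Q)) ⟨
    P * P * δ * (g * g)                     ≈⟨ *-congʳ (⁻¹-inverseʳ (pos⇒≉0 0<P²)) ⟩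
    1# * (g * g)                            ≈⟨ *-identityˡ _ ⟩
    g * g                                   ∎
    where
    open ≤-Reasoning
    Q P δ : ℝ
    Q = fromℕ 2 ^ suc j
    P = fromℕ 2 ^ (5 ℕ.+ j)
    δ = (P * P) ⁻¹
    0<P² : 0# < P * P
    0<P² = *-pos (^-pos (5 ℕ.+ j) 0<2) (^-pos (5 ℕ.+ j) 0<2)
    0<δ : 0# < δ
    0<δ = ⁻¹-pos 0<P²
    -- Of the five extra bits, one makes up for rounding log₂ X down and four give the factor 16,
    -- whose square is 256.
    P≈16Q : P ≈ # 16 * Q
    P≈16Q = trans (^-homo-* (fromℕ 2) 4 (suc j)) (*-congʳ
      (solve 0 (let two = num 1 :+ (num 1 :+ num 0) in
         two :* (two :* (two :* (two :* num 1))) := num 16) refl))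
    r<Qg : r < Q * g
    r<Qg = begin-strict
      r             ≈⟨ x/y*y≈x r (pos⇒≉0 0<g) ⟨
      r / g * g     ≈⟨ *-comm _ _ ⟩
      g * (r / g)   <⟨ *-monoˡ-< 0<g r/g<Q ⟩
      g * Q         ≈⟨ *-comm _ _ ⟩
      Q * g         ∎
    B<Q²g² : B < (Q * g) * (Q * g)
    B<Q²g² = begin-strict
      B                   ≈⟨ r²≈B ⟨
      r * r               ≤⟨ *-monoˡ-≤ 0≤r (<⇒≤ r<Qg) ⟩
      r * (Q * g)         ≈⟨ *-comm _ _ ⟩
      (Q * g) * r         <⟨ *-monoˡ-< (≤-<-trans 0≤r r<Qg) r<Qg ⟩
      (Q * g) * (Q * g)   ∎

  -- From g ≤ B ≤ 1 follows g² ≤ B. This places X in the range from 1 upwards, where the facts on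
  -- logarithms apply.
  1≤√/ : ∀ {B g r} → 0# < g → g ≤ B → B ≤ 1# → 0# ≤ r → r * r ≈ B → 1# ≤ r / g
  1≤√/ {B} {g} {r} 0<g g≤B B≤1 0≤r r²≈B = begin
    1#         ≈⟨ ⁻¹-inverseʳ (pos⇒≉0 0<g) ⟨
    g * g ⁻¹   ≤⟨ *-monoʳ-≤ (<⇒≤ (⁻¹-pos 0<g)) g≤r ⟩
    r / g      ∎
    where
    open ≤-Reasoning
    g≤r : g ≤ r
    g≤r = ≮⇒≥ λ r<g → <⇒≱ (begin-strict
      r * r   ≤⟨ *-monoˡ-≤ 0≤r (<⇒≤ r<g) ⟩
      r * g   ≈⟨ *-comm r g ⟩
      g * r   <⟨ *-monoˡ-< 0<g r<g ⟩
      g * g   ∎) (begin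
      g * g    ≤⟨ *-monoˡ-≤ (<⇒≤ 0<g) (≤-trans g≤B B≤1) ⟩
      g * 1#   ≈⟨ *-identityʳ g ⟩
      g        ≤⟨ g≤B ⟩
      B        ≈⟨ r²≈B ⟨
      r * r    ∎)

  -- The 9 bits per coordinate are 2 for the sign and the end mark, 5 from k = 5 + j, 1 on average
  -- for the unary digits and 1 for the slack in `log₂-lower`.
  space-bound : ∀ d j {L} → fromℕ j ≤ L + 1# →
    fromℕ (d ℕ.* (7 ℕ.+ j) ℕ.+ d) ≤ fromℕ d * L + fromℕ 9 * fromℕ d
  space-bound d j {L} j≤L+1 = begin
    fromℕ (d ℕ.* (7 ℕ.+ j) ℕ.+ d)
        ≈⟨ trans (fromℕ-homo-+ (d ℕ.* (7 ℕ.+ j)) d)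
             (+-congʳ (trans (fromℕ-homo-* d (7 ℕ.+ j)) (*-congˡ (fromℕ-homo-+ 7 j)))) ⟩
    D * (fromℕ 7 + fromℕ j) + D
        ≤⟨ +-mono-≤ (*-monoˡ-≤ (fromℕ-nonneg d) (+-monoʳ-≤ (fromℕ 7) j≤L+1)) ≤-refl ⟩
    D * (fromℕ 7 + (L + 1#)) + D
        ≈⟨ solve 3 (λ D L s → D :* (s :+ (L :+ num 1)) :+ D :=
             D :* L :+ (num 1 :+ (num 1 :+ s)) :* D)
             refl D L (fromℕ 7) ⟩
    D * L + fromℕ 9 * D  ∎
    where
    open ≤-Reasoning
    D : ℝ
    D = fromℕ d

  solvable : (d : ℕ) → NonZero d → (α β : ℝ) →
    0# ≤ α → α ≤ 1# → 0# ≤ β → β ≤ 1# → β < α →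
    ∃ λ (ℓ : ℕ) → NonZero ℓ × InnerProductSolution α β d ℓ ×
      fromℕ ℓ ≤ fromℕ d * log₂ ((√ (1# - β)) / (α - β)) + fromℕ 9 * fromℕ d
  solvable (suc d) _ α β 0≤α α≤1 0≤β β≤1 β<α =
    let 0<g = difference-pos β<α
        0<B = difference-pos (<-≤-trans β<α α≤1)
        0≤r , r²≈B = √-spec (<⇒≤ 0<B)
        g≤B = ≤-from-difference (difference-nonneg α≤1)
                (solve 2 (λ α β → num 1 :- α := (num 1 :- β) :- (α :- β)) refl α β)
        B≤1 = ≤-from-difference 0≤β (solve 1 (λ β → β := num 1 :- (num 1 :- β)) refl β)
        1≤X = 1≤√/ 0<g g≤B B≤1 0≤r r²≈B
        j , 2ʲ≤X , X<2ʲ⁺¹ = floorLog₂ 1≤X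
        σ , 0≤σ , σ²≈d = ∃-√ (fromℕ-nonneg (suc d))
    in Quantiser.ℓ d (5 ℕ.+ j) σ 0≤σ σ²≈d , _
     , Quantiser.solution d (5 ℕ.+ j) σ 0≤σ σ²≈d α≤1 β≤1 β<α
         (precise-enough j 0<B 0<g 0≤r r²≈B X<2ʲ⁺¹)
     , space-bound (suc d) j (log₂-lower j 1≤X 2ʲ≤X)

mainTheorem1 :
  (em : ExcludedMiddle 0ℓ) (R : CompleteOrderedField) →
  let open RealAnalysis em R in
  ∃ λ (C : ℝ) → 0# < C ×
    ((d : ℕ) → NonZero d → (α β : ℝ) →
     0# ≤ α → α ≤ 1# → 0# ≤ β → β ≤ 1# → β < α →
     ∃ λ (ℓ : ℕ) → NonZero ℓ × InnerProductSolution α β d ℓ ×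
       fromℕ ℓ ≤ fromℕ d * log₂ ((√ (1# - β)) / (α - β)) + C * fromℕ d)
mainTheorem1 em R = fromℕ 9 , fromℕ-pos 8 , solvable
  where
  open RealAnalysis em R
  open InnerProductCoding em R
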